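{- (1) For any $\lambda\in[0,1)$: $\omega\text{ - }\mathrm{RL}\not\subseteq\mathbb{L}^{>\lambda}(\mathrm{QBA}|\mathrm{D})$. (2) For any $\lambda\in[0,1)$: $\omega\text{ - }\mathrm{CFL}\setminus\omega\text{ - }\mathrm{RL}\not\subseteq\mathbb{L}^{>\lambda}(\mathrm{QBA}|\mathrm{D})$. (3) $\mathbb{L}^{=1}(\mathrm{QBA}|\mathrm{D})\not\subseteq\omega\text{ - }\mathrm{RL}$.
   Context: A quantum automaton is a tuple $\mathcal{A}=(\mathcal{H},|s_0\rangle,\Sigma,\{U_\sigma:\sigma\in\Sigma\},F)$ where $\mathcal{H}$ is a finite-dimensional complex Hilbert space, $|s_0\rangle$ a unit vector, $\Sigma$ a finite alphabet, each $U_\sigma$ unitary, and $F$ a subspace. For $w=\sigma_1\sigma_2\cdots\in\Sigma^\omega$, a unit vector $|\psi\rangle\in F$ and checkpoints $0\le n_1<n_2<\cdots$, the disturbing run is $|s_0\rangle$ and for $n\ge1$: $|s_n\rangle=U_{\sigma_n}|\psi\rangle$ if $n-1=n_i$ for some $i$, else $|s_n\rangle=U_{\sigma_n}|s_{n-1}\rangle$; $f^{\mathrm{D}}_{\mathcal{A}}(w)=\sup_{|\psi\rangle}\sup_{\{n_i\}}\inf_{i\ge1}|\langle\psi|s_{n_i}\rangle|^2$. $\mathcal{L}^{>\lambda}(\mathcal{A}|\mathrm{D})=\{w:f^{\mathrm{D}}_{\mathcal{A}}(w)>\lambda\}$, $\mathcal{L}^{=1}(\mathcal{A}|\mathrm{D})=\{w:f^{\mathrm{D}}_{\mathcal{A}}(w)=1\}$;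 $\mathbb{L}^{>\lambda}(\mathrm{QBA}|\mathrm{D})$, $\mathbb{L}^{=1}(\mathrm{QBA}|\mathrm{D})$ are the classes of all such languages over all quantum automata. $\omega\text{ - }\mathrm{RL}$ (resp. $\omega\text{ - }\mathrm{CFL}$) is the class of all $\omega$-languages $\bigcup_{i=1}^n U_iV_i^\omega$ with $U_i,V_i$ regular (resp. context-free) languages of finite words, $V^\omega$ being the set of infinite concatenations of nonempty words from $V$. -}

module Defs where

open import Level using (0ℓ) renaming (suc to lsuc)
open import Algebra.Bundles using (CommutativeRing; Ring)
open import Algebra.Module.Bundles using (LeftModule)
import Algebra.Module.Morphism.Structures as ModuleMorphisms
import Algebra.Properties.Monoid.Sum as MonoidSum
open import Data.Bool.Base using (if_then_else_)
open import Data.Fin.Base using (Fin; toℕ; fromℕ<)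
import Data.Fin.Properties as Fin
open import Data.Fin.Subset using (Subset) renaming (_∈_ to _∈ₛ_)
open import Data.List.Base using (List; []; _∷_; _++_; map; concat; length; foldl; applyUpTo)
open import Data.List.Membership.Propositional using () renaming (_∈_ to _∈ₗ_)
open import Data.Nat.Base as ℕ using (ℕ; zero; suc; s≤s; z≤n)
import Data.Nat.Properties as ℕ
open import Data.Product.Base using (Σ; ∃; _×_; _,_; proj₁; proj₂)
open import Data.Rational.Base as ℚ using (ℚ; 0ℚ; 1ℚ; ½; ∣_∣)
import Data.Rational.Properties as ℚ
open import Data.Rational.Solver using (module +-*-Solver)
open import Data.Sum.Base using (_⊎_; inj₁; inj₂)
open import Relation.Binary.Construct.Closure.ReflexiveTransitive using (Star)
open import Relation.Binary.PropositionalEquality using (_≡_; _≢_; _≗_; refl; sym; trans; cong; subst; subst₂)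
open import Relation.Nullary.Decidable using (Dec; does; map′)
open import Relation.Unary using (Pred; _≐_; _∈_)

-- Real numbers: Cauchy sequences of rationals, with setoid equality.
-- Every operation acts termwise.

Eventually : Pred ℕ 0ℓ → Set
Eventually P = ∃ λ N → ∀ n → N ℕ.≤ n → P n

record ℝ : Set where
  no-eta-equality
  field
    seq    : ℕ → ℚ
    cauchy : ∀ ε → 0ℚ ℚ.< ε →
             ∃ λ N → ∀ m n → N ℕ.≤ m → N ℕ.≤ n → ∣ seq m ℚ.- seq n ∣ ℚ.< ε

open ℝ public

infix 4 _≈ℝ_ _<ℝ_ _≤ℝ_

record _≈ℝ_ (x y : ℝ) : Set where
  constructor mk≈
  field
    close : ∀ ε → 0ℚ ℚ.< ε → Eventually (λ n → ∣ seq x n ℚ.- seq y n ∣ ℚ.< ε)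

record _<ℝ_ (x y : ℝ) : Set where
  constructor mk<
  field
    gap          : ℚ
    gap-positive : 0ℚ ℚ.< gap
    separated    : Eventually (λ n → seq x n ℚ.+ gap ℚ.≤ seq y n)

record _≤ℝ_ (x y : ℝ) : Set where
  constructor mk≤
  field
    below-up-to : ∀ ε → 0ℚ ℚ.< ε → Eventually (λ n → seq x n ℚ.≤ seq y n ℚ.+ ε)

open _≈ℝ_ public
open _<ℝ_ public
open _≤ℝ_ public

private
  module Lemmas where
    open +-*-Solver

    half-sum : ∀ ε → ½ ℚ.* ε ℚ.+ ½ ℚ.* ε ≡ ε
    half-sum = solve 1 (λ e → con ½ :* e :+ con ½ :* e := e) refl

    half-pos : ∀ {ε} → 0ℚ ℚ.< ε → 0ℚ ℚ.< ½ ℚ.* ε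
    half-pos {ε} 0<ε = subst (ℚ._< ½ ℚ.* ε) (ℚ.*-zeroʳ ½) (ℚ.*-monoʳ-<-pos ½ 0<ε)

    sum-close : ∀ {a b ε} → ∣ a ∣ ℚ.< ½ ℚ.* ε → ∣ b ∣ ℚ.< ½ ℚ.* ε → ∣ a ℚ.+ b ∣ ℚ.< ε
    sum-close {a} {b} {ε} p q =
      ℚ.≤-<-trans (ℚ.∣p+q∣≤∣p∣+∣q∣ a b) (subst (_ ℚ.<_) (half-sum ε) (ℚ.+-mono-< p q))

    neg-diff : ∀ a b → (ℚ.- a) ℚ.- (ℚ.- b) ≡ ℚ.- (a ℚ.- b)
    neg-diff = solve 2 (λ a b → (:- a) :- (:- b) := :- (a :- b)) refl

    flip-diff : ∀ a b → ℚ.- (a ℚ.- b) ≡ b ℚ.- a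
    flip-diff = solve 2 (λ a b → :- (a :- b) := b :- a) refl

    add-diff : ∀ a b c d → (a ℚ.- c) ℚ.+ (b ℚ.- d) ≡ (a ℚ.+ b) ℚ.- (c ℚ.+ d)
    add-diff = solve 4 (λ a b c d → (a :- c) :+ (b :- d) := (a :+ b) :- (c :+ d)) refl

    chain-diff : ∀ a b c → (a ℚ.- b) ℚ.+ (b ℚ.- c) ≡ a ℚ.- c
    chain-diff = solve 3 (λ a b c → (a :- b) :+ (b :- c) := a :- c) refl

    mul-diff : ∀ a b c d → a ℚ.* (b ℚ.- d) ℚ.+ d ℚ.* (a ℚ.- c) ≡ a ℚ.* b ℚ.- c ℚ.* d
    mul-diff = solve 4 (λ a b c d → a :* (b :- d) :+ d :* (a :- c) := a :* b :- c :* d) refl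

    split : ∀ a b → (a ℚ.- b) ℚ.+ b ≡ a
    split = solve 2 (λ a b → (a :- b) :+ b := a) refl

    shift : ∀ a b → (a ℚ.+ b) ℚ.+ b ≡ a ℚ.+ (b ℚ.+ b)
    shift = solve 2 (λ a b → (a :+ b) :+ b := a :+ (b :+ b)) refl

    assoc-re : ∀ a b c d e f → (a ℚ.* c ℚ.- b ℚ.* d) ℚ.* e ℚ.- (a ℚ.* d ℚ.+ b ℚ.* c) ℚ.* f ≡ a ℚ.* (c ℚ.* e ℚ.- d ℚ.* f) ℚ.- b ℚ.* (c ℚ.* f ℚ.+ d ℚ.* e)
    assoc-re = solve 6 (λ a b c d e f → (a :* c :- b :* d) :* e :- (a :* d :+ b :* c) :* f := a :* (c :* e :- d :* f) :- b :* (c :* f :+ d :* e)) refl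

    assoc-im : ∀ a b c d e f → (a ℚ.* c ℚ.- b ℚ.* d) ℚ.* f ℚ.+ (a ℚ.* d ℚ.+ b ℚ.* c) ℚ.* e ≡ a ℚ.* (c ℚ.* f ℚ.+ d ℚ.* e) ℚ.+ b ℚ.* (c ℚ.* e ℚ.- d ℚ.* f)
    assoc-im = solve 6 (λ a b c d e f → (a :* c :- b :* d) :* f :+ (a :* d :+ b :* c) :* e := a :* (c :* f :+ d :* e) :+ b :* (c :* e :- d :* f)) refl

    identityˡ-re : ∀ a b → 1ℚ ℚ.* a ℚ.- 0ℚ ℚ.* b ≡ a
    identityˡ-re = solve 2 (λ a b → con 1ℚ :* a :- con 0ℚ :* b := a) refl

    identityˡ-im : ∀ a b → 1ℚ ℚ.* b ℚ.+ 0ℚ ℚ.* a ≡ b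
    identityˡ-im = solve 2 (λ a b → con 1ℚ :* b :+ con 0ℚ :* a := b) refl

    identityʳ-re : ∀ a b → a ℚ.* 1ℚ ℚ.- b ℚ.* 0ℚ ≡ a
    identityʳ-re = solve 2 (λ a b → a :* con 1ℚ :- b :* con 0ℚ := a) refl

    identityʳ-im : ∀ a b → a ℚ.* 0ℚ ℚ.+ b ℚ.* 1ℚ ≡ b
    identityʳ-im = solve 2 (λ a b → a :* con 0ℚ :+ b :* con 1ℚ := b) refl

    distribˡ-re : ∀ a b c d e f → a ℚ.* (c ℚ.+ e) ℚ.- b ℚ.* (d ℚ.+ f) ≡ (a ℚ.* c ℚ.- b ℚ.* d) ℚ.+ (a ℚ.* e ℚ.- b ℚ.* f)
    distribˡ-re = solve 6 (λ a b c d e f → a :* (c :+ e) :- b :* (d :+ f) := (a :* c :- b :* d) :+ (a :* e :- b :* f)) refl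

    distribˡ-im : ∀ a b c d e f → a ℚ.* (d ℚ.+ f) ℚ.+ b ℚ.* (c ℚ.+ e) ≡ (a ℚ.* d ℚ.+ b ℚ.* c) ℚ.+ (a ℚ.* f ℚ.+ b ℚ.* e)
    distribˡ-im = solve 6 (λ a b c d e f → a :* (d :+ f) :+ b :* (c :+ e) := (a :* d :+ b :* c) :+ (a :* f :+ b :* e)) refl

    distribʳ-re : ∀ a b c d e f → (c ℚ.+ e) ℚ.* a ℚ.- (d ℚ.+ f) ℚ.* b ≡ (c ℚ.* a ℚ.- d ℚ.* b) ℚ.+ (e ℚ.* a ℚ.- f ℚ.* b)
    distribʳ-re = solve 6 (λ a b c d e f → (c :+ e) :* a :- (d :+ f) :* b := (c :* a :- d :* b) :+ (e :* a :- f :* b)) refl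

    distribʳ-im : ∀ a b c d e f → (c ℚ.+ e) ℚ.* b ℚ.+ (d ℚ.+ f) ℚ.* a ≡ (c ℚ.* b ℚ.+ d ℚ.* a) ℚ.+ (e ℚ.* b ℚ.+ f ℚ.* a)
    distribʳ-im = solve 6 (λ a b c d e f → (c :+ e) :* b :+ (d :+ f) :* a := (c :* b :+ d :* a) :+ (e :* b :+ f :* a)) refl

    comm-re : ∀ a b c d → a ℚ.* c ℚ.- b ℚ.* d ≡ c ℚ.* a ℚ.- d ℚ.* b
    comm-re = solve 4 (λ a b c d → a :* c :- b :* d := c :* a :- d :* b) refl

    comm-im : ∀ a b c d → a ℚ.* d ℚ.+ b ℚ.* c ≡ c ℚ.* b ℚ.+ d ℚ.* a
    comm-im = solve 4 (λ a b c d → a :* d :+ b :* c := c :* b :+ d :* a) refl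

    cong-<ε : ∀ {p q ε} → p ≡ q → ∣ p ∣ ℚ.< ε → ∣ q ∣ ℚ.< ε
    cong-<ε refl p = p

    self-close : ∀ a {ε} → 0ℚ ℚ.< ε → ∣ a ℚ.- a ∣ ℚ.< ε
    self-close a 0<ε = cong-<ε (sym (ℚ.+-inverseʳ a)) 0<ε

    module Scale (C : ℚ) (0<C : 0ℚ ℚ.< C) (ε : ℚ) (0<ε : 0ℚ ℚ.< ε) where
      instance
        C-pos : ℚ.Positive C
        C-pos = ℚ.positive 0<C
        C-nonZero : ℚ.NonZero C
        C-nonZero = ℚ.pos⇒nonZero C
        C-nonNeg : ℚ.NonNegative C
        C-nonNeg = ℚ.pos⇒nonNeg C

      δ : ℚ
      δ = (ℚ.1/ C) ℚ.* (½ ℚ.* ε)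

      C*δ : C ℚ.* δ ≡ ½ ℚ.* ε
      C*δ = trans (sym (ℚ.*-assoc C (ℚ.1/ C) (½ ℚ.* ε)))
              (trans (cong (ℚ._* (½ ℚ.* ε)) (ℚ.*-inverseʳ C)) (ℚ.*-identityˡ (½ ℚ.* ε)))

      δ-pos : 0ℚ ℚ.< δ
      δ-pos = ℚ.*-cancelˡ-<-nonNeg C
                (subst₂ ℚ._<_ (sym (ℚ.*-zeroʳ C)) (sym C*δ) (half-pos 0<ε))

      scaled : ∀ a b → ∣ a ∣ ℚ.≤ C → ∣ b ∣ ℚ.< δ → ∣ a ℚ.* b ∣ ℚ.< ½ ℚ.* ε
      scaled a b a≤C b<δ = subst₂ ℚ._<_ (sym (ℚ.∣p*q∣≡∣p∣*∣q∣ a b)) C*δ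
        (ℚ.≤-<-trans (ℚ.*-monoʳ-≤-nonNeg ∣ b ∣ {{ℚ.∣-∣-nonNeg b}} a≤C)
                     (ℚ.*-monoʳ-<-pos C b<δ))

      mul-close : ∀ a b c d → ∣ a ∣ ℚ.≤ C → ∣ d ∣ ℚ.≤ C →
                  ∣ a ℚ.- c ∣ ℚ.< δ → ∣ b ℚ.- d ∣ ℚ.< δ → ∣ a ℚ.* b ℚ.- c ℚ.* d ∣ ℚ.< ε
      mul-close a b c d a≤C d≤C ac bd = cong-<ε (mul-diff a b c d)
        (sum-close (scaled a (b ℚ.- d) a≤C bd) (scaled d (a ℚ.- c) d≤C ac))

    0<1 : 0ℚ ℚ.< 1ℚ
    0<1 = ℚ.positive⁻¹ 1ℚ

    bound : ℝ → ℚ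
    bound x = 1ℚ ℚ.+ ∣ seq x (proj₁ (cauchy x 1ℚ 0<1)) ∣

    bound-nonNeg : ∀ x → 0ℚ ℚ.≤ bound x
    bound-nonNeg x = ℚ.+-mono-≤ (ℚ.<⇒≤ 0<1) (ℚ.0≤∣p∣ (seq x (proj₁ (cauchy x 1ℚ 0<1))))

    bounded : ∀ x → Eventually (λ n → ∣ seq x n ∣ ℚ.≤ bound x)
    bounded x with cauchy x 1ℚ 0<1
    ... | N , close-N = N , λ n N≤n →
      subst (λ a → ∣ a ∣ ℚ.≤ 1ℚ ℚ.+ ∣ seq x N ∣) (split (seq x n) (seq x N))
        (ℚ.≤-trans (ℚ.∣p+q∣≤∣p∣+∣q∣ (seq x n ℚ.- seq x N) (seq x N))
          (ℚ.+-monoˡ-≤ ∣ seq x N ∣ (ℚ.<⇒≤ (close-N n N N≤n ℕ.≤-refl))))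

    bound₂ : ℝ → ℝ → ℚ
    bound₂ x y = 1ℚ ℚ.+ (bound x ℚ.+ bound y)

    bound₂-pos : ∀ x y → 0ℚ ℚ.< bound₂ x y
    bound₂-pos x y = ℚ.+-mono-<-≤ 0<1 (ℚ.+-mono-≤ (bound-nonNeg x) (bound-nonNeg y))

    ≤-bound₂ˡ : ∀ x y → bound x ℚ.≤ bound₂ x y
    ≤-bound₂ˡ x y = subst (ℚ._≤ bound₂ x y) (ℚ.+-identityˡ (bound x))
      (ℚ.+-mono-≤ (ℚ.<⇒≤ 0<1)
        (subst (ℚ._≤ bound x ℚ.+ bound y) (ℚ.+-identityʳ (bound x))
          (ℚ.+-monoʳ-≤ (bound x) (bound-nonNeg y))))

    ≤-bound₂ʳ : ∀ x y → bound y ℚ.≤ bound₂ x y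
    ≤-bound₂ʳ x y = subst (ℚ._≤ bound₂ x y) (ℚ.+-identityˡ (bound y))
      (ℚ.+-mono-≤ (ℚ.<⇒≤ 0<1)
        (subst (ℚ._≤ bound x ℚ.+ bound y) (ℚ.+-identityˡ (bound y))
          (ℚ.+-monoˡ-≤ (bound y) (bound-nonNeg x))))

    ⊔-≤ˡ : ∀ {a b c} → a ℕ.⊔ b ℕ.≤ c → a ℕ.≤ c
    ⊔-≤ˡ {a} {b} = ℕ.≤-trans (ℕ.m≤m⊔n a b)

    ⊔-≤ʳ : ∀ {a b c} → a ℕ.⊔ b ℕ.≤ c → b ℕ.≤ c
    ⊔-≤ʳ {a} {b} = ℕ.≤-trans (ℕ.m≤n⊔m a b)

  open Lemmas

fromℚ : ℚ → ℝ
seq    (fromℚ q) _ = q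
cauchy (fromℚ q) ε 0<ε = 0 , λ _ _ _ _ → self-close q 0<ε

0ℝ 1ℝ : ℝ
0ℝ = fromℚ 0ℚ
1ℝ = fromℚ 1ℚ

infixl 6 _+ℝ_
infixl 7 _*ℝ_
infix  8 -ℝ_

_+ℝ_ : ℝ → ℝ → ℝ
seq    (x +ℝ y) n = seq x n ℚ.+ seq y n
cauchy (x +ℝ y) ε 0<ε =
  let (M , x-close) = cauchy x (½ ℚ.* ε) (half-pos 0<ε)
      (N , y-close) = cauchy y (½ ℚ.* ε) (half-pos 0<ε)
  in M ℕ.⊔ N , λ m n m≥ n≥ →
       cong-<ε (add-diff (seq x m) (seq y m) (seq x n) (seq y n))
         (sum-close (x-close m n (⊔-≤ˡ m≥) (⊔-≤ˡ n≥)) (y-close m n (⊔-≤ʳ {M} m≥) (⊔-≤ʳ {M} n≥)))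

-ℝ_ : ℝ → ℝ
seq    (-ℝ x) n = ℚ.- seq x n
cauchy (-ℝ x) ε 0<ε =
  let (N , x-close) = cauchy x ε 0<ε
  in N , λ m n m≥ n≥ →
       cong-<ε (sym (trans (neg-diff (seq x m) (seq x n)) (flip-diff (seq x m) (seq x n))))
         (x-close n m n≥ m≥)

_*ℝ_ : ℝ → ℝ → ℝ
seq    (x *ℝ y) n = seq x n ℚ.* seq y n
cauchy (x *ℝ y) ε 0<ε =
  let open Scale (bound₂ x y) (bound₂-pos x y) ε 0<ε
      (K , x-bounded) = bounded x
      (L , y-bounded) = bounded y
      (M , x-close) = cauchy x δ δ-pos
      (N , y-close) = cauchy y δ δ-pos
  in (K ℕ.⊔ L) ℕ.⊔ (M ℕ.⊔ N) , λ m n m≥ n≥ →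
       mul-close (seq x m) (seq y m) (seq x n) (seq y n)
         (ℚ.≤-trans (x-bounded m (⊔-≤ˡ (⊔-≤ˡ m≥))) (≤-bound₂ˡ x y))
         (ℚ.≤-trans (y-bounded n (⊔-≤ʳ {K} (⊔-≤ˡ n≥))) (≤-bound₂ʳ x y))
         (x-close m n (⊔-≤ˡ (⊔-≤ʳ {K ℕ.⊔ L} m≥)) (⊔-≤ˡ (⊔-≤ʳ {K ℕ.⊔ L} n≥)))
         (y-close m n (⊔-≤ʳ {M} (⊔-≤ʳ {K ℕ.⊔ L} m≥)) (⊔-≤ʳ {M} (⊔-≤ʳ {K ℕ.⊔ L} n≥)))

termwise : ∀ {x y} → seq x ≗ seq y → x ≈ℝ y
termwise {x} {y} x≗y = mk≈ λ ε 0<ε → 0 , λ n _ →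
  cong-<ε (cong (λ a → seq x n ℚ.- a) (x≗y n)) (self-close (seq x n) 0<ε)

≈ℝ-refl : ∀ {x} → x ≈ℝ x
≈ℝ-refl = termwise λ _ → refl

≈ℝ-sym : ∀ {x y} → x ≈ℝ y → y ≈ℝ x
≈ℝ-sym {x} {y} x≈y = mk≈ λ ε 0<ε →
  let (N , xy-close) = close x≈y ε 0<ε
  in N , λ n n≥ → cong-<ε (flip-diff (seq x n) (seq y n))
       (subst (ℚ._< ε) (sym (ℚ.∣-p∣≡∣p∣ (seq x n ℚ.- seq y n))) (xy-close n n≥))

≈ℝ-trans : ∀ {x y z} → x ≈ℝ y → y ≈ℝ z → x ≈ℝ z
≈ℝ-trans {x} {y} {z} x≈y y≈z = mk≈ λ ε 0<ε →
  let (M , xy-close) = close x≈y (½ ℚ.* ε) (half-pos 0<ε)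
      (N , yz-close) = close y≈z (½ ℚ.* ε) (half-pos 0<ε)
  in M ℕ.⊔ N , λ n n≥ → cong-<ε (chain-diff (seq x n) (seq y n) (seq z n))
       (sum-close (xy-close n (⊔-≤ˡ n≥)) (yz-close n (⊔-≤ʳ {M} n≥)))

+ℝ-cong : ∀ {x y u v} → x ≈ℝ y → u ≈ℝ v → x +ℝ u ≈ℝ y +ℝ v
+ℝ-cong {x} {y} {u} {v} x≈y u≈v = mk≈ λ ε 0<ε →
  let (M , xy-close) = close x≈y (½ ℚ.* ε) (half-pos 0<ε)
      (N , uv-close) = close u≈v (½ ℚ.* ε) (half-pos 0<ε)
  in M ℕ.⊔ N , λ n n≥ → cong-<ε (add-diff (seq x n) (seq u n) (seq y n) (seq v n))
       (sum-close (xy-close n (⊔-≤ˡ n≥)) (uv-close n (⊔-≤ʳ {M} n≥)))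

-ℝ-cong : ∀ {x y} → x ≈ℝ y → -ℝ x ≈ℝ -ℝ y
-ℝ-cong {x} {y} x≈y = mk≈ λ ε 0<ε →
  let (N , xy-close) = close x≈y ε 0<ε
  in N , λ n n≥ → cong-<ε (sym (neg-diff (seq x n) (seq y n)))
       (subst (ℚ._< ε) (sym (ℚ.∣-p∣≡∣p∣ (seq x n ℚ.- seq y n))) (xy-close n n≥))

*ℝ-cong : ∀ {x y u v} → x ≈ℝ y → u ≈ℝ v → x *ℝ u ≈ℝ y *ℝ v
*ℝ-cong {x} {y} {u} {v} x≈y u≈v = mk≈ λ ε 0<ε →
  let open Scale (bound₂ x v) (bound₂-pos x v) ε 0<ε
      (K , x-bounded) = bounded x
      (L , v-bounded) = bounded v
      (M , xy-close) = close x≈y δ δ-pos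
      (N , uv-close) = close u≈v δ δ-pos
  in (K ℕ.⊔ L) ℕ.⊔ (M ℕ.⊔ N) , λ n n≥ →
       mul-close (seq x n) (seq u n) (seq y n) (seq v n)
         (ℚ.≤-trans (x-bounded n (⊔-≤ˡ (⊔-≤ˡ n≥))) (≤-bound₂ˡ x v))
         (ℚ.≤-trans (v-bounded n (⊔-≤ʳ {K} (⊔-≤ˡ n≥))) (≤-bound₂ʳ x v))
         (xy-close n (⊔-≤ˡ (⊔-≤ʳ {K ℕ.⊔ L} n≥)))
         (uv-close n (⊔-≤ʳ {M} (⊔-≤ʳ {K ℕ.⊔ L} n≥)))

record ℂ : Set where
  no-eta-equality
  field
    re im : ℝ

open ℂ public

infix 4 _≈ℂ_

record _≈ℂ_ (z w : ℂ) : Set where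
  constructor mk≈ℂ
  field
    re-≈ : re z ≈ℝ re w
    im-≈ : im z ≈ℝ im w

open _≈ℂ_ public

infixl 6 _+ℂ_
infixl 7 _*ℂ_
infix  8 -ℂ_

0ℂ 1ℂ : ℂ
re 0ℂ = 0ℝ
im 0ℂ = 0ℝ
re 1ℂ = 1ℝ
im 1ℂ = 0ℝ

_+ℂ_ _*ℂ_ : ℂ → ℂ → ℂ
re (z +ℂ w) = re z +ℝ re w
im (z +ℂ w) = im z +ℝ im w
re (z *ℂ w) = re z *ℝ re w +ℝ -ℝ (im z *ℝ im w)
im (z *ℂ w) = re z *ℝ im w +ℝ im z *ℝ re w

-ℂ_ conj : ℂ → ℂ
re (-ℂ z)   = -ℝ re z
im (-ℂ z)   = -ℝ im z
re (conj z) = re z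
im (conj z) = -ℝ im z

∣_∣² : ℂ → ℝ
∣ z ∣² = re z *ℝ re z +ℝ im z *ℝ im z

ℂ-commutativeRing : CommutativeRing 0ℓ 0ℓ
ℂ-commutativeRing = record
  { Carrier = ℂ ; _≈_ = _≈ℂ_ ; _+_ = _+ℂ_ ; _*_ = _*ℂ_ ; -_ = -ℂ_ ; 0# = 0ℂ ; 1# = 1ℂ
  ; isCommutativeRing = record
    { isRing = record
      { +-isAbelianGroup = record
        { isGroup = record
          { isMonoid = record
            { isSemigroup = record
              { isMagma = record
                { isEquivalence = record
                  { refl  = mk≈ℂ ≈ℝ-refl ≈ℝ-refl
                  ; sym   = λ p → mk≈ℂ (≈ℝ-sym (re-≈ p)) (≈ℝ-sym (im-≈ p))
                  ; trans = λ p q → mk≈ℂ (≈ℝ-trans (re-≈ p) (re-≈ q)) (≈ℝ-trans (im-≈ p) (im-≈ q))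
                  }
                ; ∙-cong = λ p q → mk≈ℂ (+ℝ-cong (re-≈ p) (re-≈ q)) (+ℝ-cong (im-≈ p) (im-≈ q))
                }
              ; assoc = λ x y z → mk≈ℂ
                  (termwise λ n → ℚ.+-assoc (seq (re x) n) (seq (re y) n) (seq (re z) n))
                  (termwise λ n → ℚ.+-assoc (seq (im x) n) (seq (im y) n) (seq (im z) n))
              }
            ; identity =
                (λ x → mk≈ℂ (termwise λ n → ℚ.+-identityˡ (seq (re x) n))
                            (termwise λ n → ℚ.+-identityˡ (seq (im x) n))) ,
                (λ x → mk≈ℂ (termwise λ n → ℚ.+-identityʳ (seq (re x) n))
                            (termwise λ n → ℚ.+-identityʳ (seq (im x) n)))
            }
          ; inverse =
              (λ x → mk≈ℂ (termwise λ n → ℚ.+-inverseˡ (seq (re x) n))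
                          (termwise λ n → ℚ.+-inverseˡ (seq (im x) n))) ,
              (λ x → mk≈ℂ (termwise λ n → ℚ.+-inverseʳ (seq (re x) n))
                          (termwise λ n → ℚ.+-inverseʳ (seq (im x) n)))
          ; ⁻¹-cong = λ p → mk≈ℂ (-ℝ-cong (re-≈ p)) (-ℝ-cong (im-≈ p))
          }
        ; comm = λ x y → mk≈ℂ
            (termwise λ n → ℚ.+-comm (seq (re x) n) (seq (re y) n))
            (termwise λ n → ℚ.+-comm (seq (im x) n) (seq (im y) n))
        }
      ; *-cong = λ p q → mk≈ℂ
          (+ℝ-cong (*ℝ-cong (re-≈ p) (re-≈ q)) (-ℝ-cong (*ℝ-cong (im-≈ p) (im-≈ q))))
          (+ℝ-cong (*ℝ-cong (re-≈ p) (im-≈ q)) (*ℝ-cong (im-≈ p) (re-≈ q)))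
      ; *-assoc = λ x y z → mk≈ℂ
          (termwise λ n → assoc-re (seq (re x) n) (seq (im x) n) (seq (re y) n) (seq (im y) n) (seq (re z) n) (seq (im z) n))
          (termwise λ n → assoc-im (seq (re x) n) (seq (im x) n) (seq (re y) n) (seq (im y) n) (seq (re z) n) (seq (im z) n))
      ; *-identity =
          (λ x → mk≈ℂ
            (termwise λ n → identityˡ-re (seq (re x) n) (seq (im x) n))
            (termwise λ n → identityˡ-im (seq (re x) n) (seq (im x) n))) ,
          (λ x → mk≈ℂ
            (termwise λ n → identityʳ-re (seq (re x) n) (seq (im x) n))
            (termwise λ n → identityʳ-im (seq (re x) n) (seq (im x) n)))
      ; distrib =
          (λ x y z → mk≈ℂ
            (termwise λ n → distribˡ-re (seq (re x) n) (seq (im x) n) (seq (re y) n) (seq (im y) n) (seq (re z) n) (seq (im z) n))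
            (termwise λ n → distribˡ-im (seq (re x) n) (seq (im x) n) (seq (re y) n) (seq (im y) n) (seq (re z) n) (seq (im z) n))) ,
          (λ x y z → mk≈ℂ
            (termwise λ n → distribʳ-re (seq (re x) n) (seq (im x) n) (seq (re y) n) (seq (im y) n) (seq (re z) n) (seq (im z) n))
            (termwise λ n → distribʳ-im (seq (re x) n) (seq (im x) n) (seq (re y) n) (seq (im y) n) (seq (re z) n) (seq (im z) n)))
      }
    ; *-comm = λ x y → mk≈ℂ
        (termwise λ n → comm-re (seq (re x) n) (seq (im x) n) (seq (re y) n) (seq (im y) n))
        (termwise λ n → comm-im (seq (re x) n) (seq (im x) n) (seq (re y) n) (seq (im y) n))
    }
  }

ℂ-ring : Ring 0ℓ 0ℓ
ℂ-ring = CommutativeRing.ring ℂ-commutativeRing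

-- The inner product is linear in its second argument.  Completeness
-- needs no field: it follows from the finite orthonormal basis.
record HilbertSpace : Set₁ where
  field
    vectorSpace : LeftModule ℂ-ring 0ℓ 0ℓ

  open LeftModule vectorSpace public

  infix 9 ⟨_∣_⟩

  field
    ⟨_∣_⟩      : Carrierᴹ → Carrierᴹ → ℂ
    ⟨∣⟩-cong   : ∀ {x x′ y y′} → x ≈ᴹ x′ → y ≈ᴹ y′ → ⟨ x ∣ y ⟩ ≈ℂ ⟨ x′ ∣ y′ ⟩
    ⟨∣⟩-+ʳ     : ∀ x y z → ⟨ x ∣ y +ᴹ z ⟩ ≈ℂ ⟨ x ∣ y ⟩ +ℂ ⟨ x ∣ z ⟩
    ⟨∣⟩-*ʳ     : ∀ c x y → ⟨ x ∣ c *ₗ y ⟩ ≈ℂ c *ℂ ⟨ x ∣ y ⟩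
    ⟨∣⟩-conj   : ∀ x y → ⟨ x ∣ y ⟩ ≈ℂ conj ⟨ y ∣ x ⟩
    ⟨∣⟩-nonNeg : ∀ x → 0ℝ ≤ℝ re ⟨ x ∣ x ⟩
    ⟨∣⟩-def    : ∀ x → ⟨ x ∣ x ⟩ ≈ℂ 0ℂ → x ≈ᴹ 0ᴹ

  open MonoidSum +ᴹ-monoid public using (sum)

  field
    dim         : ℕ
    basis       : Fin dim → Carrierᴹ
    orthonormal : ∀ i j → ⟨ basis i ∣ basis j ⟩ ≈ℂ (if does (i Fin.≟ j) then 1ℂ else 0ℂ)
    spanning    : ∀ x → ∃ λ (c : Fin dim → ℂ) → x ≈ᴹ sum (λ i → c i *ₗ basis i)

  IsUnit : Pred Carrierᴹ 0ℓ
  IsUnit x = ⟨ x ∣ x ⟩ ≈ℂ 1ℂ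

module _ (H : HilbertSpace) where
  open HilbertSpace H
  open ModuleMorphisms.LeftModuleMorphisms rawLeftModule rawLeftModule

  record IsUnitary (U : Carrierᴹ → Carrierᴹ) : Set where
    field
      isLinear  : IsLeftModuleHomomorphism U
      _†        : Carrierᴹ → Carrierᴹ
      isAdjoint : ∀ x y → ⟨ _† x ∣ y ⟩ ≈ℂ ⟨ x ∣ U y ⟩
      inverseˡ  : ∀ x → _† (U x) ≈ᴹ x
      inverseʳ  : ∀ x → U (_† x) ≈ᴹ x

  record Subspace : Set₁ where
    field
      Member   : Pred Carrierᴹ 0ℓ
      resp     : ∀ {x y} → x ≈ᴹ y → Member x → Member y
      0-closed : Member 0ᴹ
      +-closed : ∀ {x y} → Member x → Member y → Member (x +ᴹ y)
      *-closed : ∀ c {x} → Member x → Member (c *ₗ x)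

-- Suprema and infima of arbitrary families of reals need not be Cauchy
-- reals constructively; they are taken among lower Dedekind cuts, where
-- below L q says that q < L.  (A supremum over an empty family is −∞.)

record LowerReal : Set₁ where
  field
    below      : Pred ℚ 0ℓ
    downClosed : ∀ {p q} → p ℚ.< q → below q → below p
    rounded    : ∀ {p} → below p → ∃ λ q → p ℚ.< q × below q

open LowerReal public

fromℝ : ℝ → LowerReal
fromℝ x = record
  { below      = λ q → fromℚ q <ℝ x
  ; downClosed = λ p<q q<x →
      let (N , q+gap≤x) = separated q<x
      in mk< (gap q<x) (gap-positive q<x)
           (N , λ n n≥ → ℚ.≤-trans (ℚ.+-monoˡ-≤ (gap q<x) (ℚ.<⇒≤ p<q)) (q+gap≤x n n≥))
  ; rounded    = λ {p} p<x →
      let (N , p+gap≤x) = separated p<x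
          h = ½ ℚ.* gap p<x
          0<h = half-pos (gap-positive p<x)
      in p ℚ.+ h ,
         subst (ℚ._< p ℚ.+ h) (ℚ.+-identityʳ p) (ℚ.+-monoʳ-< p 0<h) ,
         mk< h 0<h (N , λ n n≥ →
           subst (ℚ._≤ seq x n)
             (sym (trans (shift p h) (cong (p ℚ.+_) (half-sum (gap p<x))))) (p+gap≤x n n≥))
  }

⨆ : {I : Set} → (I → LowerReal) → LowerReal
⨆ L = record
  { below      = λ q → ∃ λ i → below (L i) q
  ; downClosed = λ { p<q (i , q∈) → i , downClosed (L i) p<q q∈ }
  ; rounded    = λ { (i , p∈) → let (q , p<q , q∈) = rounded (L i) p∈ in q , p<q , i , q∈ }
  }

⨅ : {I : Set} → (I → LowerReal) → LowerReal
⨅ L = record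
  { below      = λ q → ∃ λ r → q ℚ.< r × (∀ i → below (L i) r)
  ; downClosed = λ { p<q (r , q<r , r∈) → r , ℚ.<-trans p<q q<r , r∈ }
  ; rounded    = λ { (r , p<r , r∈) → let (q , p<q , q<r) = ℚ.<-dense p<r in q , p<q , r , q<r , r∈ }
  }

infix 4 _>ᴸ_ _≈ᴸ_

_>ᴸ_ : LowerReal → ℝ → Set
L >ᴸ x = ∃ λ q → x <ℝ fromℚ q × below L q

_≈ᴸ_ : LowerReal → LowerReal → Set
K ≈ᴸ L = below K ≐ below L

ωWord : ℕ → Set
ωWord k = ℕ → Fin k

-- The class of languages ranges over all finite alphabets, so a language
-- carries the size of its alphabet.
ωLanguage : Set₁
ωLanguage = Σ ℕ λ k → Pred (ωWord k) 0ℓ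

record QuantumAutomaton (k : ℕ) : Set₁ where
  field
    H : HilbertSpace

  open HilbertSpace H public

  field
    s₀        : Carrierᴹ
    s₀-unit   : IsUnit s₀
    U         : Fin k → Carrierᴹ → Carrierᴹ
    U-unitary : ∀ σ → IsUnitary H (U σ)
    F         : Subspace H

  open Subspace F public

-- at i is the checkpoint n_{i+1}.
record Checkpoints : Set where
  field
    at         : ℕ → ℕ
    increasing : ∀ i → at i ℕ.< at (suc i)

  index≤at : ∀ i → i ℕ.≤ at i
  index≤at zero    = z≤n
  index≤at (suc i) = ℕ.≤-trans (s≤s (index≤at i)) (increasing i)

  isCheckpoint? : ∀ n → Dec (∃ λ i → at i ≡ n)
  isCheckpoint? n = map′
    (λ { (i , eq) → toℕ i , eq })
    (λ { (i , eq) → fromℕ< (s≤s (subst (i ℕ.≤_) eq (index≤at i))) ,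
                     trans (cong at (Fin.toℕ-fromℕ< _)) eq })
    (Fin.any? {n = suc n} λ i → at (toℕ i) ℕ.≟ n)

open Checkpoints public

module _ {k : ℕ} (A : QuantumAutomaton k) where
  open QuantumAutomaton A

  -- The letter w n is σ_{n+1}.
  run : ωWord k → Carrierᴹ → Checkpoints → ℕ → Carrierᴹ
  run w ψ c zero    = s₀
  run w ψ c (suc n) = U (w n) (if does (isCheckpoint? c n) then ψ else run w ψ c n)

  fᴰ : ωWord k → LowerReal
  fᴰ w =
    ⨆ {I = Σ Carrierᴹ λ ψ → Member ψ × IsUnit ψ} λ (ψ , _) →
    ⨆ {I = Checkpoints} λ c →
    ⨅ {I = ℕ} λ i → fromℝ ∣ ⟨ ψ ∣ run w ψ c (at c i) ⟩ ∣²

  L^>_ : ℝ → Pred (ωWord k) 0ℓ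
  (L^> x) w = fᴰ w >ᴸ x

  L^=1 : Pred (ωWord k) 0ℓ
  L^=1 w = fᴰ w ≈ᴸ fromℝ 1ℝ

𝕃^> : ℝ → Pred ωLanguage (lsuc 0ℓ)
𝕃^> x (k , L) = Σ (QuantumAutomaton k) λ A → L ≐ (L^> A) x

𝕃^=1 : Pred ωLanguage (lsuc 0ℓ)
𝕃^=1 (k , L) = Σ (QuantumAutomaton k) λ A → L ≐ L^=1 A

Language : ℕ → Set₁
Language k = Pred (List (Fin k)) 0ℓ

record DFA (k : ℕ) : Set where
  field
    states    : ℕ
    initial   : Fin states
    step      : Fin states → Fin k → Fin states
    accepting : Subset states

  Accepts : Language k
  Accepts w = foldl step initial w ∈ₛ accepting

Regular : ∀ {k} → Pred (Language k) 0ℓ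
Regular {k} L = ∃ λ (M : DFA k) → L ≐ DFA.Accepts M

record CFG (k : ℕ) : Set where
  field
    nonterminals : ℕ
    start        : Fin nonterminals

  Symbol : Set
  Symbol = Fin nonterminals ⊎ Fin k

  field
    productions : List (Fin nonterminals × List Symbol)

  data _⇒_ : List Symbol → List Symbol → Set where
    rewriteWith : ∀ {X γ} → (X , γ) ∈ₗ productions →
                  ∀ α β → (α ++ inj₁ X ∷ β) ⇒ (α ++ γ ++ β)

  Generates : Language k
  Generates w = Star _⇒_ (inj₁ start ∷ []) (map inj₂ w)

ContextFree : ∀ {k} → Pred (Language k) 0ℓ
ContextFree {k} L = ∃ λ (G : CFG k) → L ≐ CFG.Generates G

_++ω_ : ∀ {k} → List (Fin k) → ωWord k → ωWord k
([]      ++ω x) n       = x n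
((a ∷ u) ++ω x) zero    = a
((a ∷ u) ++ω x) (suc n) = (u ++ω x) n

_IsPrefixOf_ : ∀ {k} → List (Fin k) → ωWord k → Set
u IsPrefixOf x = applyUpTo x (length u) ≡ u

_^ω : ∀ {k} → Language k → Pred (ωWord k) 0ℓ
(V ^ω) x = ∃ λ v → (∀ i → v i ∈ V × v i ≢ []) ×
                   (∀ n → concat (applyUpTo v n) IsPrefixOf x)

_·_ : ∀ {k} → Language k → Pred (ωWord k) 0ℓ → Pred (ωWord k) 0ℓ
(U · X) w = ∃ λ u → ∃ λ x → u ∈ U × x ∈ X × w ≗ (u ++ω x)

ωClosure : (∀ {k} → Pred (Language k) 0ℓ) → Pred ωLanguage (lsuc 0ℓ)
ωClosure 𝒞 (k , L) =
  Σ ℕ λ n → Σ (Fin n → Language k) λ U → Σ (Fin n → Language k) λ V →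
    (∀ i → 𝒞 (U i) × 𝒞 (V i)) × (L ≐ λ w → ∃ λ i → w ∈ U i · (V i ^ω))

ω-RL ω-CFL : Pred ωLanguage (lsuc 0ℓ)
ω-RL  = ωClosure Regular
ω-CFL = ωClosure ContextFree

{-# OPTIONS --safe #-}

-- Unitary orbits in finite dimension recur: by pigeonhole on coordinates,
-- for every letter d, vector φ and ε > 0 some m ≥ 1 has
-- |⟨φ|U_d^m s₀⟩ − ⟨φ|s₀⟩| < ε.  Putting dᵐ in front of an accepted word and
-- delaying the checkpoints changes only the first amplitude, and that one
-- arbitrarily little, so a strict threshold language that is not empty
-- contains a word starting with d.  Hence a nonempty language over an
-- alphabet with an unused letter is never a strict threshold language; this
-- applies to the ω-regular {0^ω} and to {aⁿbⁿ}c^ω, which is not ω-regular by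
-- pumping.
--
-- For (3), let a rotate the real plane by an angle θ with θ/π irrational, let b
-- rotate back, let c act trivially, and let F be the initial line.  On
-- aⁿbᵐc^ω only finitely many angles occur, so fidelities close enough to 1
-- force every checkpoint to lie at angle 0, whence n = m; pumping again
-- excludes ω-regularity.
module Submission where

open import Defs
open import Algebra.Bundles using (CommutativeRing)
import Algebra.Module.Construct.DirectProduct as DirectProduct
import Algebra.Module.Construct.TensorUnit as TensorUnit
open import Algebra.Module.Bundles using (LeftModule)
import Algebra.Properties.CommutativeSemigroup as CommutativeSemigroup
import Algebra.Properties.Monoid.Sum as MonoidSum
open import Data.Bool.Base using (if_then_else_)
open import Data.Empty using (⊥-elim)
open import Data.Fin.Base using (Fin; zero; suc; toℕ; join; splitAt; combine; funToFin; finToFun)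
import Data.Fin.Properties as Fin
open import Data.Fin.Subset using (⁅_⁆) renaming (_∈_ to _∈ₛ_)
open import Data.Fin.Subset.Properties using (x∈⁅x⁆; x∈⁅y⁆⇒x≡y)
open import Data.Integer.Base as ℤ using (ℤ; +_)
import Data.Integer.Properties as ℤ
open import Data.Integer.Solver using () renaming (module +-*-Solver to ℤ-Solver)
open import Data.List.Base using (List; []; _∷_; _++_; map; replicate; concat; length; foldl; applyUpTo)
open import Data.List.Membership.Propositional using () renaming (_∈_ to _∈ₗ_)
open import Data.List.Properties using (∷-injective; length-replicate; map-injective; map-++; map-replicate)
open import Data.List.Relation.Unary.Any using (here; there)
open import Data.Nat.Base as ℕ using (ℕ; zero; suc; s≤s; z≤n)
import Data.Nat.Coprimality as Coprime
import Data.Nat.Properties as ℕ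
open import Data.Product.Base using (∃; ∃₂; _×_; _,_; proj₁; proj₂)
open import Data.Rational.Base as ℚ using (ℚ; mkℚ; 0ℚ; 1ℚ; ½; ∣_∣)
import Data.Rational.Properties as ℚ
open import Data.Rational.Solver using (module +-*-Solver)
open import Data.Rational.Unnormalised.Base using (*≡*)
import Data.Rational.Unnormalised.Properties as ℚᵘ
open import Data.Sum.Base using (_⊎_; inj₁; inj₂)
open import Data.Sum.Properties using (inj₂-injective)
open import Function.Base using (_∘_; case_of_)
open import Function.Bundles using (mk⇔)
open import Level using (0ℓ)
open import Relation.Binary.Construct.Closure.ReflexiveTransitive using (Star; _◅_; _◅◅_) renaming (ε to ε⋆)
open import Relation.Binary.PropositionalEquality using (_≡_; _≢_; _≗_; refl; sym; trans; cong; cong₂; subst; subst₂)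
open import Relation.Binary.PropositionalEquality using (module ≡-Reasoning)
import Relation.Binary.Reasoning.Setoid as SetoidReasoning
open import Relation.Nullary using (Dec; yes; no; contradiction; ¬_; does)
open import Relation.Nullary.Decidable using (does-⇔; dec-false; toWitnessFalse)
open import Relation.Unary using (Pred; _≐_; _∈_; _∉_; _⊆_; _⊈_; _∩_; _∖_)

open +-*-Solver using (solve; con; _:+_; _:*_; _:-_; :-_; _:=_)
open ℤ-Solver using () renaming (solve to solveℤ; con to conℤ; _:+_ to _⊕_; _:*_ to _⊗_; _:=_ to _⊜_)

-- Infinite words and powers

-- Reals are Cauchy sequences without a decidable order, and values of words are lower cuts.
-- Membership in a strict threshold language is therefore data: a unit vector ψ in F, checkpoints,
-- and a rational above the threshold that all fidelities exceed. That surplus is the budget against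
-- which the return time m is chosen. Only the first amplitude changes because of the reset: behind
-- the first checkpoint the run depends on ψ and on the later letters alone. Recurrence is required
-- for a single pair of vectors only, because adjoints move the evolution up to the first checkpoint
-- onto ψ. In (3) the obstacle is that the checkpoints disturb the run and might help a wrong word.
-- But F is a line, so ψ is the initial vector up to a phase, and a reset at angle 0 alters nothing
-- but the phase. Value one is a supremum that need not be attained, so fidelities must be kept away
-- from one. This needs a bound on the angle along the word: over all nonzero multiples of θ the
-- supremum of cos² is one. Pumping only shortens the b-block, so words with m ≤ n suffice and all
-- angles are natural multiples of θ.

private
  variable
    k : ℕ

++ω-cong : ∀ (u : List (Fin k)) {x y : ωWord k} → x ≗ y → (u ++ω x) ≗ (u ++ω y)
++ω-cong []      x≗y n       = x≗y n
++ω-cong (a ∷ u) x≗y zero    = refl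
++ω-cong (a ∷ u) x≗y (suc n) = ++ω-cong u x≗y n

++ω-assoc : ∀ (u v : List (Fin k)) (x : ωWord k) → ((u ++ v) ++ω x) ≗ (u ++ω (v ++ω x))
++ω-assoc []      v x n       = refl
++ω-assoc (a ∷ u) v x zero    = refl
++ω-assoc (a ∷ u) v x (suc n) = ++ω-assoc u v x n

++ω-drop : ∀ (u : List (Fin k)) (x : ωWord k) n → (u ++ω x) (length u ℕ.+ n) ≡ x n
++ω-drop []      x n = refl
++ω-drop (a ∷ u) x n = ++ω-drop u x n

prefix-resp : ∀ (u : List (Fin k)) {x y : ωWord k} → x ≗ y → u IsPrefixOf x → u IsPrefixOf y
prefix-resp []      x≗y p = refl
prefix-resp (a ∷ u) x≗y p with ∷-injective p
... | x0≡a , p′ = cong₂ _∷_ (trans (sym (x≗y 0)) x0≡a) (prefix-resp u (x≗y ∘ suc) p′)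

++-prefix : ∀ (u : List (Fin k)) {t : List (Fin k)} {y : ωWord k} → t IsPrefixOf y → (u ++ t) IsPrefixOf (u ++ω y)
++-prefix []      p = p
++-prefix (a ∷ u) p = cong (a ∷_) (++-prefix u p)

dropω : ℕ → ωWord k → ωWord k
dropω m x n = x (m ℕ.+ n)

prefix⇒≗ : ∀ (u : List (Fin k)) {x : ωWord k} → u IsPrefixOf x → x ≗ (u ++ω dropω (length u) x)
prefix⇒≗ []      p n       = refl
prefix⇒≗ (a ∷ u) p zero    = proj₁ (∷-injective p)
prefix⇒≗ (a ∷ u) p (suc n) = prefix⇒≗ u (proj₂ (∷-injective p)) n

prefix-++ : ∀ (u : List (Fin k)) {t : List (Fin k)} {x : ωWord k} →
            (u ++ t) IsPrefixOf x → u IsPrefixOf x × t IsPrefixOf (dropω (length u) x)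
prefix-++ []      p = refl , p
prefix-++ (a ∷ u) p with ∷-injective p
... | x0≡a , p′ with prefix-++ u p′
... | q , r = cong₂ _∷_ x0≡a q , r

^ω-resp : ∀ (V : Language k) {x y} → x ≗ y → (V ^ω) x → (V ^ω) y
^ω-resp V x≗y (v , v∈V , p) = v , v∈V , λ n → prefix-resp (concat (applyUpTo v n)) x≗y (p n)

^ω-mono : ∀ {V V′ : Language k} → V ⊆ V′ → (V ^ω) ⊆ (V′ ^ω)
^ω-mono V⊆V′ (v , v∈V , p) = v , (λ i → V⊆V′ (proj₁ (v∈V i)) , proj₂ (v∈V i)) , p

·-mono : ∀ {U U′ : Language k} {X X′ : Pred (ωWord k) _} → U ⊆ U′ → X ⊆ X′ → (U · X) ⊆ (U′ · X′)
·-mono U⊆ X⊆ (u , x , u∈ , x∈ , eq) = u , x , U⊆ u∈ , X⊆ x∈ , eq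

·-resp : ∀ {U : Language k} {X : Pred (ωWord k) _} {w w′} → w ≗ w′ → (U · X) w → (U · X) w′
·-resp w≗w′ (u , x , u∈ , x∈ , eq) = u , x , u∈ , x∈ , λ n → trans (sym (w≗w′ n)) (eq n)

NonEmpty : Language k
NonEmpty u = u ≢ []

-- With its converse `^ω-cons` this presents V^ω as a fixed point, so that an ω-word can be consumed
-- one V-word at a time; `NonEmpty` ensures progress by at least one letter.
^ω-uncons : ∀ {V : Language k} → (V ^ω) ⊆ ((V ∩ NonEmpty) · (V ^ω))
^ω-uncons {V = V} {x} (v , v∈V , p) =
  v 0 , dropω (length (v 0)) x , v∈V 0 ,
  (v ∘ suc , v∈V ∘ suc , λ n → proj₂ (prefix-++ (v 0) (p (suc n)))) ,
  prefix⇒≗ (v 0) (proj₁ (prefix-++ (v 0) (p 1)))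

^ω-cons : ∀ {V : Language k} → ((V ∩ NonEmpty) · (V ^ω)) ⊆ (V ^ω)
^ω-cons {k} {V} {w} (u , x , u∈ , (v , v∈V , p) , w≗) =
  ^ω-resp V (sym ∘ w≗) (v′ , v′∈ , p′)
  where
  v′ : ℕ → List (Fin k)
  v′ zero    = u
  v′ (suc i) = v i

  v′∈ : ∀ i → v′ i ∈ V × v′ i ≢ []
  v′∈ zero    = u∈
  v′∈ (suc i) = v∈V i

  p′ : ∀ n → concat (applyUpTo v′ n) IsPrefixOf (u ++ω x)
  p′ zero    = refl
  p′ (suc n) = ++-prefix u (p n)

-- Pumping for ω-regular languages

module Pumping (M N : DFA k) where

  Config : Set
  Config = Fin (DFA.states M) ⊎ Fin (DFA.states N)

  From : (D : DFA k) → Fin (DFA.states D) → Language k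
  From D q u = foldl (DFA.step D) q u ∈ₛ DFA.accepting D

  Vω : Pred (ωWord k) _
  Vω = DFA.Accepts N ^ω

  -- inj₁ q: still inside the U-word, in state q of M;
  -- inj₂ q: inside a V-word with letters still to come, in state q of N.
  Acc : Config → Pred (ωWord k) _
  Acc (inj₁ q) = From M q · Vω
  Acc (inj₂ q) = (From N q ∩ NonEmpty) · Vω

  Acc-resp : ∀ κ {w w′} → w ≗ w′ → Acc κ w → Acc κ w′
  Acc-resp (inj₁ q) = ·-resp
  Acc-resp (inj₂ q) = ·-resp

  -- This is what the pigeonhole argument exploits: prefixes leading to the same configuration may
  -- exchange their tails.
  Continues : Config → List (Fin k) → Config → Set
  Continues κ u κ′ = ∀ {y} → Acc κ′ y → Acc κ (u ++ω y)

  -- The factorisation of the accepted word resolves the nondeterminism. When the letter read ends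
  -- its V-word, the next V-word is fetched at once, because `inj₂` promises letters still to come.
  letterV : ∀ q {w} → Acc (inj₂ q) w →
            ∃ λ κ → Acc κ (w ∘ suc) × Continues (inj₂ q) (w 0 ∷ []) κ
  letterV q ([] , x , (_ , ne) , _) = ⊥-elim (ne refl)
  letterV q {w} (a ∷ [] , x , (q∈ , ne) , x∈ , w≗) =
    inj₂ (DFA.initial N) , ^ω-uncons (^ω-resp (DFA.Accepts N) (sym ∘ w≗ ∘ suc) x∈) ,
    λ {y} y∈ → w 0 ∷ [] , y , (subst (λ b → From N q (b ∷ [])) (sym (w≗ 0)) q∈ , λ ()) , ^ω-cons y∈ , λ _ → refl
  letterV q {w} (a ∷ b ∷ v , x , (q∈ , ne) , x∈ , w≗) =
    inj₂ (DFA.step N q (w 0)) ,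
    (b ∷ v , x , (subst (λ c → From N q (c ∷ b ∷ v)) (sym (w≗ 0)) q∈ , λ ()) , x∈ , w≗ ∘ suc) ,
    λ { (v′ , x′ , (q∈′ , _) , x∈′ , eq) →
        w 0 ∷ v′ , x′ , (q∈′ , λ ()) , x∈′ , λ { zero → refl ; (suc n) → eq n } }

  letter : ∀ κ {w} → Acc κ w → ∃ λ κ′ → Acc κ′ (w ∘ suc) × Continues κ (w 0 ∷ []) κ′
  letter (inj₂ q) w∈ = letterV q w∈
  -- With the U-word exhausted the letter already belongs to the first V-word: an ε-move to the
  -- initial state of `N`.
  letter (inj₁ q) {w} ([] , x , q∈ , x∈ , w≗)
    with letterV (DFA.initial N) (^ω-uncons (^ω-resp (DFA.Accepts N) (sym ∘ w≗) x∈))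
  ... | κ′ , tail∈ , back = κ′ , tail∈ , λ {y} y∈ → [] , _ , q∈ , ^ω-cons (back y∈) , λ _ → refl
  letter (inj₁ q) {w} (a ∷ u , x , q∈ , x∈ , w≗) =
    inj₁ (DFA.step M q (w 0)) ,
    (u , x , subst (λ c → From M q (c ∷ u)) (sym (w≗ 0)) q∈ , x∈ , w≗ ∘ suc) ,
    λ { (u′ , x′ , q∈′ , x∈′ , eq) →
        w 0 ∷ u′ , x′ , q∈′ , x∈′ , λ { zero → refl ; (suc n) → eq n } }

  prefix : ∀ κ u {y} → Acc κ (u ++ω y) → ∃ λ κ′ → Acc κ′ y × Continues κ u κ′
  prefix κ []      y∈ = κ , y∈ , λ z∈ → z∈
  prefix κ (a ∷ u) y∈ with letter κ y∈
  ... | κ₁ , uy∈ , back₁ with prefix κ₁ u uy∈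
  ... | κ₂ , y∈′ , back₂ = κ₂ , y∈′ , λ {z} z∈ →
    Acc-resp κ (λ { zero → refl ; (suc n) → refl }) (back₁ (back₂ z∈))

  size : ℕ
  size = DFA.states M ℕ.+ DFA.states N

  encode : Config → Fin size
  encode = join (DFA.states M) (DFA.states N)

  encode-injective : ∀ κ κ′ → encode κ ≡ encode κ′ → κ ≡ κ′
  encode-injective κ κ′ eq =
    trans (sym (Fin.splitAt-join _ _ κ))
          (trans (cong (splitAt (DFA.states M)) eq) (Fin.splitAt-join _ _ κ′))

  -- The prefixes b^0, ..., b^n outnumber the configurations. If b^i and b^j with i < j lead to the
  -- same one, the tail behind b^j may follow b^i, which leaves i + (n - j) letters.
  pump : ∀ κ (b : Fin k) n {y} → size ℕ.≤ n → Acc κ (replicate n b ++ω y) →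
         ∃ λ m → m ℕ.< n × Acc κ (replicate m b ++ω y)
  pump κ b n {y} size≤n w∈ = shorten (Fin.pigeonhole (s≤s size≤n) (encode ∘ proj₁ ∘ at-prefix))
    where
    replicate-split : ∀ s t → (replicate (s ℕ.+ t) b ++ω y) ≗ (replicate s b ++ω (replicate t b ++ω y))
    replicate-split zero    t i       = refl
    replicate-split (suc s) t zero    = refl
    replicate-split (suc s) t (suc i) = replicate-split s t i

    at-prefix : (i : Fin (suc n)) → ∃ λ κ′ →
      Acc κ′ (replicate (n ℕ.∸ toℕ i) b ++ω y) × Continues κ (replicate (toℕ i) b) κ′
    at-prefix i = prefix κ (replicate (toℕ i) b)
      (Acc-resp κ
        (λ j → trans (cong (λ l → (replicate l b ++ω y) j) (sym (ℕ.m+[n∸m]≡n (Fin.toℕ≤pred[n] i))))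
                     (replicate-split (toℕ i) (n ℕ.∸ toℕ i) j))
        w∈)

    shorten : (∃₂ λ i j → toℕ i ℕ.< toℕ j × encode (proj₁ (at-prefix i)) ≡ encode (proj₁ (at-prefix j))) →
              ∃ λ m → m ℕ.< n × Acc κ (replicate m b ++ω y)
    shorten (i , j , i<j , eq) =
      toℕ i ℕ.+ (n ℕ.∸ toℕ j) ,
      subst (toℕ i ℕ.+ (n ℕ.∸ toℕ j) ℕ.<_) (ℕ.m+[n∸m]≡n (Fin.toℕ≤pred[n] j))
            (ℕ.+-monoˡ-< (n ℕ.∸ toℕ j) i<j) ,
      Acc-resp κ (sym ∘ replicate-split (toℕ i) (n ℕ.∸ toℕ j))
        (proj₂ (proj₂ (at-prefix i))
          (subst (λ κ′ → Acc κ′ (replicate (n ℕ.∸ toℕ j) b ++ω y))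
            (sym (encode-injective (proj₁ (at-prefix i)) (proj₁ (at-prefix j)) eq)) (proj₁ (proj₂ (at-prefix j)))))

upper-bound : ∀ {n} (f : Fin n → ℕ) → ∃ λ N → ∀ i → f i ℕ.≤ N
upper-bound {zero}  f = 0 , λ ()
upper-bound {suc n} f with upper-bound (f ∘ suc)
... | N , f≤N = f zero ℕ.⊔ N , λ
  { zero    → ℕ.m≤m⊔n (f zero) N
  ; (suc i) → ℕ.≤-trans (f≤N i) (ℕ.m≤n⊔m (f zero) N) }

constω : Fin k → ωWord k
constω c _ = c

blocks : Fin k → Fin k → Fin k → ℕ → ℕ → ωWord k
blocks a b c n m = replicate n a ++ω (replicate m b ++ω constω c)

-- Which of the finitely many products accepts a diagonal word is not known beforehand, so the block
-- length is a bound for the sizes of all pairs of automata. The a-block is read first and kept; the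
-- pigeonhole acts inside the b-block.
ω-RL-pumping : ∀ {L : Pred (ωWord k) _} (a b c : Fin k) → (k , L) ∈ ω-RL →
               (∀ n → blocks a b c n n ∈ L) →
               ∃ λ n → ∃ λ m → m ℕ.< n × blocks a b c n m ∈ L
ω-RL-pumping {k} {L} a b c (n , U , V , regular , L⊆ , ⊆L) diag =
  N , pumped (L⊆ (diag N))
  where
  M₁ M₂ : Fin n → DFA k
  M₁ i = proj₁ (proj₁ (regular i))
  M₂ i = proj₁ (proj₂ (regular i))

  bounded : ∃ λ N → ∀ i → Pumping.size (M₁ i) (M₂ i) ℕ.≤ N
  bounded = upper-bound λ i → Pumping.size (M₁ i) (M₂ i)

  N : ℕ
  N = proj₁ bounded

  pumped : (∃ λ i → (U i · (V i ^ω)) (blocks a b c N N)) →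
           ∃ λ m → m ℕ.< N × blocks a b c N m ∈ L
  pumped (i , w∈) = continue (P.prefix (inj₁ (DFA.initial (M₁ i))) (replicate N a) w∈′)
    where
    module P = Pumping (M₁ i) (M₂ i)

    U≐ : U i ≐ DFA.Accepts (M₁ i)
    U≐ = proj₂ (proj₁ (regular i))

    V≐ : V i ≐ DFA.Accepts (M₂ i)
    V≐ = proj₂ (proj₂ (regular i))

    w∈′ : P.Acc (inj₁ (DFA.initial (M₁ i))) (blocks a b c N N)
    w∈′ = ·-mono (λ {u} → proj₁ U≐ {u}) (^ω-mono (λ {v} → proj₁ V≐ {v})) w∈

    continue : (∃ λ κ → P.Acc κ (replicate N b ++ω constω c) ×
                        P.Continues (inj₁ (DFA.initial (M₁ i))) (replicate N a) κ) →
               ∃ λ m → m ℕ.< N × blocks a b c N m ∈ L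
    continue (κ , y∈ , back) =
      proj₁ pumped-y , proj₁ (proj₂ pumped-y) ,
      ⊆L (i , ·-mono (λ {u} → proj₂ U≐ {u}) (^ω-mono (λ {v} → proj₂ V≐ {v})) (back (proj₂ (proj₂ pumped-y))))
      where
      pumped-y : ∃ λ m → m ℕ.< N × P.Acc κ (replicate m b ++ω constω c)
      pumped-y = P.pump κ b N (proj₂ bounded i) y∈

-- Integers inside ℚ

-- Built by `mkℚ` and not by division, so that the numerator stays visible to unification in
-- `fromℤ-injective`.
fromℤ : ℤ → ℚ
fromℤ i = mkℚ i 0 (Coprime.sym (Coprime.1-coprimeTo ℤ.∣ i ∣))

fromℤ-+ : ∀ i j → fromℤ (i ℤ.+ j) ≡ fromℤ i ℚ.+ fromℤ j
fromℤ-+ i j = ℚ.toℚᵘ-injective (ℚᵘ.≃-trans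
  (*≡* (solveℤ 2 (λ x y → (x ⊕ y) ⊗ conℤ (+ 1) ⊜ (x ⊗ conℤ (+ 1) ⊕ y ⊗ conℤ (+ 1)) ⊗ conℤ (+ 1)) refl i j))
  (ℚᵘ.≃-sym (ℚ.toℚᵘ-homo-+ (fromℤ i) (fromℤ j))))

fromℤ-* : ∀ i j → fromℤ (i ℤ.* j) ≡ fromℤ i ℚ.* fromℤ j
fromℤ-* i j = ℚ.toℚᵘ-injective (ℚᵘ.≃-trans (*≡* refl) (ℚᵘ.≃-sym (ℚ.toℚᵘ-homo-* (fromℤ i) (fromℤ j))))

fromℤ-injective : ∀ {i j} → fromℤ i ≡ fromℤ j → i ≡ j
fromℤ-injective refl = refl

2ℚ : ℚ
2ℚ = fromℤ (+ 2)

-- Rational inequalities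

p≤∣p∣ : ∀ p → p ℚ.≤ ∣ p ∣
p≤∣p∣ p with ℚ.∣p∣≡p∨∣p∣≡-p p
... | inj₁ eq = ℚ.≤-reflexive (sym eq)
... | inj₂ eq with ℚ.≤-total p 0ℚ
... | inj₁ p≤0 = ℚ.≤-trans p≤0 (ℚ.0≤∣p∣ p)
... | inj₂ 0≤p = ℚ.≤-reflexive (sym (ℚ.0≤p⇒∣p∣≡p 0≤p))

-p≤∣p∣ : ∀ p → ℚ.- p ℚ.≤ ∣ p ∣
-p≤∣p∣ p = subst (ℚ.- p ℚ.≤_) (ℚ.∣-p∣≡∣p∣ p) (p≤∣p∣ (ℚ.- p))

≤⇒∣∣≤ : ∀ {p q} → p ℚ.≤ q → ℚ.- p ℚ.≤ q → ∣ p ∣ ℚ.≤ q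
≤⇒∣∣≤ {p} {q} p≤q -p≤q with ℚ.∣p∣≡p∨∣p∣≡-p p
... | inj₁ eq = subst (ℚ._≤ q) (sym eq) p≤q
... | inj₂ eq = subst (ℚ._≤ q) (sym eq) -p≤q

*-mono-≤-nonNeg : ∀ {p q r s} → 0ℚ ℚ.≤ p → 0ℚ ℚ.≤ r → p ℚ.≤ q → r ℚ.≤ s → p ℚ.* r ℚ.≤ q ℚ.* s
*-mono-≤-nonNeg {p} {q} {r} {s} 0≤p 0≤r p≤q r≤s =
  ℚ.≤-trans (ℚ.*-monoʳ-≤-nonNeg r {{ℚ.nonNegative 0≤r}} p≤q)
            (ℚ.*-monoˡ-≤-nonNeg q {{ℚ.nonNegative (ℚ.≤-trans 0≤p p≤q)}} r≤s)

0≤p*p : ∀ p → 0ℚ ℚ.≤ p ℚ.* p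
0≤p*p p = subst (0ℚ ℚ.≤_) (eq (ℚ.∣p∣≡p∨∣p∣≡-p p))
  (*-mono-≤-nonNeg ℚ.≤-refl ℚ.≤-refl (ℚ.0≤∣p∣ p) (ℚ.0≤∣p∣ p))
  where
  eq : ∣ p ∣ ≡ p ⊎ ∣ p ∣ ≡ ℚ.- p → ∣ p ∣ ℚ.* ∣ p ∣ ≡ p ℚ.* p
  eq (inj₁ e) = cong₂ ℚ._*_ e e
  eq (inj₂ e) = trans (cong₂ ℚ._*_ e e) (solve 1 (λ x → (:- x) :* (:- x) := x :* x) refl p)

∣p∣*∣p∣ : ∀ p → ∣ p ∣ ℚ.* ∣ p ∣ ≡ p ℚ.* p
∣p∣*∣p∣ p = trans (sym (ℚ.∣p*q∣≡∣p∣*∣q∣ p p)) (ℚ.0≤p⇒∣p∣≡p (0≤p*p p))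

half-positive : ∀ {ε} → 0ℚ ℚ.< ε → 0ℚ ℚ.< ½ ℚ.* ε
half-positive {ε} 0<ε = subst (ℚ._< ½ ℚ.* ε) (ℚ.*-zeroʳ ½) (ℚ.*-monoʳ-<-pos ½ 0<ε)

half+half : ∀ ε → ½ ℚ.* ε ℚ.+ ½ ℚ.* ε ≡ ε
half+half = solve 1 (λ e → con ½ :* e :+ con ½ :* e := e) refl

half≤ : ∀ {ε} → 0ℚ ℚ.< ε → ½ ℚ.* ε ℚ.≤ ε
half≤ {ε} 0<ε = subst₂ ℚ._≤_ (ℚ.+-identityʳ (½ ℚ.* ε)) (half+half ε)
  (ℚ.+-monoʳ-≤ (½ ℚ.* ε) (ℚ.<⇒≤ (half-positive 0<ε)))

p<q⇒0<q-p : ∀ {p q} → p ℚ.< q → 0ℚ ℚ.< q ℚ.- p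
p<q⇒0<q-p {p} {q} p<q = subst (ℚ._< q ℚ.- p) (ℚ.+-inverseʳ p) (ℚ.+-monoˡ-< (ℚ.- p) p<q)

∃-divide : ∀ {C g} → 0ℚ ℚ.< C → 0ℚ ℚ.< g → ∃ λ η → 0ℚ ℚ.< η × C ℚ.* η ≡ g
∃-divide {C} {g} 0<C 0<g = η , 0<η , C*η
  where
  instance
    C-pos : ℚ.Positive C
    C-pos = ℚ.positive 0<C
    C-nonZero : ℚ.NonZero C
    C-nonZero = ℚ.pos⇒nonZero C
  η : ℚ
  η = (ℚ.1/ C) ℚ.* g
  C*η : C ℚ.* η ≡ g
  C*η = trans (sym (ℚ.*-assoc C (ℚ.1/ C) g))
          (trans (cong (ℚ._* g) (ℚ.*-inverseʳ C)) (ℚ.*-identityˡ g))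
  0<η : 0ℚ ℚ.< η
  0<η = ℚ.*-cancelˡ-<-nonNeg C {{ℚ.pos⇒nonNeg C}} (subst₂ ℚ._<_ (sym (ℚ.*-zeroʳ C)) (sym C*η) 0<g)

-- A denominator is at least one, so the size of the numerator alone is a bound.
≤-fromℤ : ∀ q → q ℚ.≤ fromℤ (+ ℤ.∣ ℚ.↥ q ∣)
≤-fromℤ (mkℚ (+ n) d _) = ℚ.*≤* (ℤ.*-monoˡ-≤-nonNeg (+ n) (ℤ.+≤+ (s≤s z≤n)))
≤-fromℤ (mkℚ ℤ.-[1+ n ] d _) = ℚ.*≤* ℤ.-≤+

archimedean : ∀ {s} → 0ℚ ℚ.< s → ∀ q → ∃ λ K → q ℚ.≤ fromℤ (+ K) ℚ.* s
archimedean {s} 0<s q with ∃-divide 0<s (ℚ.positive⁻¹ 1ℚ)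
... | t , 0<t , s*t≡1 = K , subst (ℚ._≤ fromℤ (+ K) ℚ.* s)
    (trans (ℚ.*-assoc q t s) (trans (cong (q ℚ.*_) (trans (ℚ.*-comm t s) s*t≡1)) (ℚ.*-identityʳ q)))
    (ℚ.*-monoʳ-≤-nonNeg s {{ℚ.nonNegative (ℚ.<⇒≤ 0<s)}} (≤-fromℤ (q ℚ.* t)))
  where
  K : ℕ
  K = ℤ.∣ ℚ.↥ (q ℚ.* t) ∣

-- Eventual bounds

private
  variable
    x y : ℝ
    A B : ℚ

eventually₂ : ∀ {P Q R : ℕ → Set} → (∀ n → P n → Q n → R n) → Eventually P → Eventually Q → Eventually R
eventually₂ f (M , p) (N , q) = M ℕ.⊔ N , λ n n≥ →
  f n (p n (ℕ.≤-trans (ℕ.m≤m⊔n M N) n≥)) (q n (ℕ.≤-trans (ℕ.m≤n⊔m M N) n≥))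

eventually : ∀ {P Q : ℕ → Set} → (∀ n → P n → Q n) → Eventually P → Eventually Q
eventually f (N , p) = N , λ n n≥ → f n (p n n≥)

-- Bounds on the terms add and multiply without loss; only the passage to an equal real costs an ε,
-- in `bounded-≈`.
record Bounded (x : ℝ) (B : ℚ) : Set where
  constructor mkBounded
  field
    eventually-≤ : Eventually λ n → ∣ seq x n ∣ ℚ.≤ B

bounded-mono : A ℚ.≤ B → Bounded x A → Bounded x B
bounded-mono A≤B (mkBounded x≤) = mkBounded (eventually (λ n p → ℚ.≤-trans p A≤B) x≤)

bounded-termwise : seq x ≗ seq y → Bounded x A → Bounded y A
bounded-termwise x≗y (mkBounded x≤) =
  mkBounded (eventually (λ n → subst (λ a → ∣ a ∣ ℚ.≤ _) (x≗y n)) x≤)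

bounded-+ : Bounded x A → Bounded y B → Bounded (x +ℝ y) (A ℚ.+ B)
bounded-+ {x} {_} {y} (mkBounded x≤) (mkBounded y≤) = mkBounded (eventually₂
  (λ n p q → ℚ.≤-trans (ℚ.∣p+q∣≤∣p∣+∣q∣ (seq x n) (seq y n)) (ℚ.+-mono-≤ p q)) x≤ y≤)

bounded-neg : Bounded x A → Bounded (-ℝ x) A
bounded-neg {x} (mkBounded x≤) = mkBounded (eventually
  (λ n → subst (ℚ._≤ _) (sym (ℚ.∣-p∣≡∣p∣ (seq x n)))) x≤)

bounded-* : Bounded x A → Bounded y B → Bounded (x *ℝ y) (A ℚ.* B)
bounded-* {x} {_} {y} (mkBounded x≤) (mkBounded y≤) = mkBounded (eventually₂
  (λ n p q → subst (ℚ._≤ _) (sym (ℚ.∣p*q∣≡∣p∣*∣q∣ (seq x n) (seq y n)))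
    (*-mono-≤-nonNeg (ℚ.0≤∣p∣ (seq x n)) (ℚ.0≤∣p∣ (seq y n)) p q)) x≤ y≤)

bounded-≈ : ∀ {ε} → 0ℚ ℚ.< ε → x ≈ℝ y → Bounded x A → Bounded y (A ℚ.+ ε)
bounded-≈ {x} {y} {A} {ε} 0<ε x≈y (mkBounded x≤) = mkBounded (eventually₂
  (λ n p q → subst (λ a → ∣ a ∣ ℚ.≤ A ℚ.+ ε)
    (solve 2 (λ a b → a :- (a :- b) := b) refl (seq x n) (seq y n))
    (ℚ.≤-trans (ℚ.∣p-q∣≤∣p∣+∣q∣ (seq x n) (seq x n ℚ.- seq y n)) (ℚ.+-mono-≤ p (ℚ.<⇒≤ q))))
  x≤ (close x≈y ε 0<ε))

-- A term of the sequence serves if its index lies beyond both the start of the bound and the Cauchy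
-- index for δ.
rational-approximation : ∀ x {δ} → 0ℚ ℚ.< δ → Bounded x B →
                         ∃ λ p → ∣ p ∣ ℚ.≤ B × Bounded (x +ℝ -ℝ fromℚ p) δ
rational-approximation x {δ} 0<δ (mkBounded (M , x≤B)) with cauchy x δ 0<δ
... | N , x-close = seq x (M ℕ.⊔ N) , x≤B (M ℕ.⊔ N) (ℕ.m≤m⊔n M N) ,
      mkBounded (N , λ n n≥ → ℚ.<⇒≤ (x-close n (M ℕ.⊔ N) n≥ (ℕ.m≤n⊔m M N)))

∃-bound : ∀ x → ∃ λ B → 0ℚ ℚ.< B × Bounded x B
∃-bound x with cauchy x 1ℚ (ℚ.positive⁻¹ 1ℚ)
... | N , x-close = 1ℚ ℚ.+ ∣ seq x N ∣ , ℚ.+-mono-<-≤ (ℚ.positive⁻¹ 1ℚ) (ℚ.0≤∣p∣ (seq x N)) ,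
  mkBounded (N , λ n n≥ → subst (λ a → ∣ a ∣ ℚ.≤ 1ℚ ℚ.+ ∣ seq x N ∣)
    (solve 2 (λ a b → (a :- b) :+ b := a) refl (seq x n) (seq x N))
    (ℚ.≤-trans (ℚ.∣p+q∣≤∣p∣+∣q∣ (seq x n ℚ.- seq x N) (seq x N))
      (ℚ.+-monoˡ-≤ ∣ seq x N ∣ (ℚ.<⇒≤ (x-close n N n≥ ℕ.≤-refl)))))

record Boundedℂ (z : ℂ) (B : ℚ) : Set where
  constructor mkBoundedℂ
  field
    re-bounded : Bounded (re z) B
    im-bounded : Bounded (im z) B

open Boundedℂ

infixl 6 _-ℂ_

_-ℂ_ : ℂ → ℂ → ℂ
z -ℂ w = z +ℂ -ℂ w

boundedℂ-* : ∀ {z w} → Boundedℂ z A → Boundedℂ w B → Boundedℂ (z *ℂ w) (A ℚ.* B ℚ.+ A ℚ.* B)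
boundedℂ-* (mkBoundedℂ zr zi) (mkBoundedℂ wr wi) = mkBoundedℂ
  (bounded-+ (bounded-* zr wr) (bounded-neg (bounded-* zi wi)))
  (bounded-+ (bounded-* zr wi) (bounded-* zi wr))

-- Close pairs by pigeonhole

-- The lower end moves with the recursion, so that in `locate` the upper end of the remaining grid
-- agrees by definition.
gridPoint : ℚ → ℚ → ℕ → ℚ
gridPoint s lo zero    = lo
gridPoint s lo (suc t) = gridPoint s (lo ℚ.+ s) t

gridPoint-closed : ∀ s lo t → gridPoint s lo t ≡ lo ℚ.+ fromℤ (+ t) ℚ.* s
gridPoint-closed s lo zero    = solve 2 (λ l s → l := l :+ con 0ℚ :* s) refl lo s
gridPoint-closed s lo (suc t) = trans (gridPoint-closed s (lo ℚ.+ s) t) (trans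
  (solve 3 (λ l s i → (l :+ s) :+ i :* s := l :+ (con 1ℚ :+ i) :* s) refl lo s (fromℤ (+ t)))
  (cong (λ i → lo ℚ.+ i ℚ.* s) (sym (fromℤ-+ (+ 1) (+ t)))))

locate : ∀ {s} → 0ℚ ℚ.< s → ∀ K {lo p} → lo ℚ.≤ p → p ℚ.≤ gridPoint s lo K →
         ∃ λ (t : Fin (suc K)) → ∣ p ℚ.- gridPoint s lo (toℕ t) ∣ ℚ.≤ s
locate {s} 0<s zero {lo} {p} lo≤p p≤lo = zero ,
  subst (λ a → ∣ a ∣ ℚ.≤ s)
    (sym (trans (cong (ℚ._- lo) (ℚ.≤-antisym p≤lo lo≤p)) (ℚ.+-inverseʳ lo))) (ℚ.<⇒≤ 0<s)
locate {s} 0<s (suc K) {lo} {p} lo≤p p≤hi with ℚ.≤-total p (lo ℚ.+ s)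
... | inj₁ p≤lo+s = zero , ≤⇒∣∣≤
  (subst (p ℚ.- lo ℚ.≤_) (solve 2 (λ l s → (l :+ s) :- l := s) refl lo s) (ℚ.+-monoˡ-≤ (ℚ.- lo) p≤lo+s))
  (ℚ.≤-trans
    (subst₂ ℚ._≤_ (solve 2 (λ p l → l :- p := :- (p :- l)) refl p lo) (ℚ.+-inverseʳ p) (ℚ.+-monoˡ-≤ (ℚ.- p) lo≤p))
    (ℚ.<⇒≤ 0<s))
... | inj₂ lo+s≤p with locate 0<s K lo+s≤p p≤hi
... | t , near = suc t , near

module Cells {s : ℚ} (0<s : 0ℚ ℚ.< s) (K : ℕ) (2≤last : 2ℚ ℚ.≤ gridPoint s (ℚ.- 2ℚ) K) where

  size : ℕ
  size = suc K

  centre : Fin size → ℚ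
  centre t = gridPoint s (ℚ.- 2ℚ) (toℕ t)

  -- Reals cannot be compared decidably, so a rational approximation is located instead: s is lost
  -- to the approximation and s to the grid. Reals near a boundary may get different cells, but the
  -- argument uses only that a common cell implies closeness.
  cell : ∀ x → Bounded x 2ℚ →
         ∃ λ (t : Fin size) → Bounded (x +ℝ -ℝ fromℚ (centre t)) (s ℚ.+ s)
  cell x x≤2 = nearest (rational-approximation x 0<s x≤2)
    where
    nearest : (∃ λ p → ∣ p ∣ ℚ.≤ 2ℚ × Bounded (x +ℝ -ℝ fromℚ p) s) →
              ∃ λ (t : Fin size) → Bounded (x +ℝ -ℝ fromℚ (centre t)) (s ℚ.+ s)
    nearest (p , ∣p∣≤2 , x≈p) = proj₁ located , bounded-termwise
      {x = (x +ℝ -ℝ fromℚ p) +ℝ fromℚ (p ℚ.- g)} {y = x +ℝ -ℝ fromℚ g}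
      (λ n → solve 3 (λ x p g → (x :- p) :+ (p :- g) := x :- g) refl (seq x n) p g)
      (bounded-+ {x = x +ℝ -ℝ fromℚ p} {y = fromℚ (p ℚ.- g)} x≈p (mkBounded (0 , λ _ _ → proj₂ located)))
      where
      -2≤p : ℚ.- 2ℚ ℚ.≤ p
      -2≤p = subst (ℚ.- 2ℚ ℚ.≤_) (solve 1 (λ p → :- (:- p) := p) refl p) (ℚ.neg-antimono-≤ (ℚ.≤-trans (-p≤∣p∣ p) ∣p∣≤2))

      located : ∃ λ (t : Fin size) → ∣ p ℚ.- centre t ∣ ℚ.≤ s
      located = locate 0<s K -2≤p (ℚ.≤-trans (ℚ.≤-trans (p≤∣p∣ p) ∣p∣≤2) 2≤last)

      g : ℚ
      g = centre (proj₁ located)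

  same-cell : ∀ x y (x≤2 : Bounded x 2ℚ) (y≤2 : Bounded y 2ℚ) →
              proj₁ (cell x x≤2) ≡ proj₁ (cell y y≤2) → Bounded (y +ℝ -ℝ x) ((s ℚ.+ s) ℚ.+ (s ℚ.+ s))
  same-cell x y x≤2 y≤2 eq = 
    bounded-termwise {x = (y +ℝ -ℝ fromℚ g) +ℝ -ℝ (x +ℝ -ℝ fromℚ g)} {y = y +ℝ -ℝ x}
      (λ n → solve 3 (λ x y g → (y :- g) :- (x :- g) := y :- x) refl (seq x n) (seq y n) g)
      (bounded-+ {x = y +ℝ -ℝ fromℚ g} {y = -ℝ (x +ℝ -ℝ fromℚ g)}
        (subst (λ t → Bounded (y +ℝ -ℝ fromℚ (centre t)) (s ℚ.+ s)) (sym eq) (proj₂ (cell y y≤2)))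
        (bounded-neg {x = x +ℝ -ℝ fromℚ g} (proj₂ (cell x x≤2))))
    where
    g : ℚ
    g = centre (proj₁ (cell x x≤2))

  -- The cells of all real and imaginary parts are packed into one number below a fixed bound, so
  -- one index more than that bound forces a repetition in all coordinates at once.
  close-pair : ∀ {d} (f : ℕ → Fin d → ℂ) → (∀ i j → Boundedℂ (f i j) 2ℚ) →
               ∃₂ λ i i′ → i ℕ.< i′ × (∀ j → Boundedℂ (f i′ j -ℂ f i j) ((s ℚ.+ s) ℚ.+ (s ℚ.+ s)))
  close-pair {d} f f≤2 = found (Fin.pigeonhole (ℕ.n<1+n _) (cells ∘ toℕ))
    where
    cellℂ : ℕ → Fin d → Fin (size ℕ.* size)
    cellℂ i j = combine (proj₁ (cell (re (f i j)) (re-bounded (f≤2 i j)))) (proj₁ (cell (im (f i j)) (im-bounded (f≤2 i j))))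

    cells : ℕ → Fin ((size ℕ.* size) ℕ.^ d)
    cells i = funToFin (cellℂ i)

    found : (∃₂ λ i i′ → toℕ i ℕ.< toℕ i′ × cells (toℕ i) ≡ cells (toℕ i′)) →
            ∃₂ λ i i′ → i ℕ.< i′ × (∀ j → Boundedℂ (f i′ j -ℂ f i j) ((s ℚ.+ s) ℚ.+ (s ℚ.+ s)))
    found (i , i′ , i<i′ , eq) = toℕ i , toℕ i′ , i<i′ , λ j →
      let cell≡ = trans (sym (Fin.finToFun-funToFin (cellℂ (toℕ i)) j))
                    (trans (cong (λ c → finToFun c j) eq) (Fin.finToFun-funToFin (cellℂ (toℕ i′)) j))
          re≡ , im≡ = Fin.combine-injective _ _ _ _ cell≡
      in mkBoundedℂ
        (same-cell (re (f (toℕ i) j)) (re (f (toℕ i′) j)) (re-bounded (f≤2 (toℕ i) j)) (re-bounded (f≤2 (toℕ i′) j)) re≡)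
        (same-cell (im (f (toℕ i) j)) (im (f (toℕ i′) j)) (im-bounded (f≤2 (toℕ i) j)) (im-bounded (f≤2 (toℕ i′) j)) im≡)

close-pair : ∀ {γ} → 0ℚ ℚ.< γ → ∀ {d} (f : ℕ → Fin d → ℂ) → (∀ i j → Boundedℂ (f i j) 2ℚ) →
             ∃₂ λ i i′ → i ℕ.< i′ × (∀ j → Boundedℂ (f i′ j -ℂ f i j) γ)
close-pair {γ} 0<γ {d} f f≤2 = rescale (Cells.close-pair 0<s K 2≤last f f≤2)
  where
  -- Two reals in one cell differ by at most 4s: each is within 2s of the common centre.
  s : ℚ
  s = ½ ℚ.* (½ ℚ.* γ)

  0<s : 0ℚ ℚ.< s
  0<s = half-positive (half-positive 0<γ)

  -- The grid starts at -2 and has to reach 2, hence the length 4.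
  K : ℕ
  K = proj₁ (archimedean 0<s (2ℚ ℚ.+ 2ℚ))

  2≤last : 2ℚ ℚ.≤ gridPoint s (ℚ.- 2ℚ) K
  2≤last = subst (2ℚ ℚ.≤_) (sym (gridPoint-closed s (ℚ.- 2ℚ) K))
    (ℚ.+-monoʳ-≤ (ℚ.- 2ℚ) (proj₂ (archimedean 0<s (2ℚ ℚ.+ 2ℚ))))

  4s≡γ : (s ℚ.+ s) ℚ.+ (s ℚ.+ s) ≡ γ
  4s≡γ = trans (cong₂ ℚ._+_ (half+half (½ ℚ.* γ)) (half+half (½ ℚ.* γ))) (half+half γ)

  rescale : (∃₂ λ i i′ → i ℕ.< i′ × (∀ j → Boundedℂ (f i′ j -ℂ f i j) ((s ℚ.+ s) ℚ.+ (s ℚ.+ s)))) →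
            ∃₂ λ i i′ → i ℕ.< i′ × (∀ j → Boundedℂ (f i′ j -ℂ f i j) γ)
  rescale (i , i′ , i<i′ , near) = i , i′ , i<i′ , λ j → subst (Boundedℂ (f i′ j -ℂ f i j)) 4s≡γ (near j)

-- Perturbation of squared moduli

module ℂR = CommutativeRing ℂ-commutativeRing
open MonoidSum ℂR.+-monoid using (sum-cong-≋; sum-replicate-zero) renaming (sum to sumℂ)

p≤p+q : ∀ {p q} → 0ℚ ℚ.≤ q → p ℚ.≤ p ℚ.+ q
p≤p+q {p} {q} 0≤q = subst (ℚ._≤ p ℚ.+ q) (ℚ.+-identityʳ p) (ℚ.+-monoʳ-≤ p 0≤q)

p≤q+p : ∀ {p q} → 0ℚ ℚ.≤ q → p ℚ.≤ q ℚ.+ p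
p≤q+p {p} {q} 0≤q = subst (ℚ._≤ q ℚ.+ p) (ℚ.+-identityˡ p) (ℚ.+-monoˡ-≤ p 0≤q)

<ℝ-resp-≈ : ∀ {r x y} → fromℚ r <ℝ x → x ≈ℝ y → fromℚ r <ℝ y
<ℝ-resp-≈ {r} {x} {y} (mk< g 0<g r+g≤x) x≈y = mk< (½ ℚ.* g) (half-positive 0<g)
  (eventually₂ (λ n p q → subst₂ ℚ._≤_
      (trans (cong (λ a → r ℚ.+ a ℚ.- ½ ℚ.* g) (sym (half+half g)))
             (solve 2 (λ r h → (r :+ (h :+ h)) :- h := r :+ h) refl r (½ ℚ.* g)))
      (solve 2 (λ a b → a :- (a :- b) := b) refl (seq x n) (seq y n))
      (ℚ.+-mono-≤ p (ℚ.neg-antimono-≤ (ℚ.≤-trans (p≤∣p∣ _) (ℚ.<⇒≤ q)))))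
    r+g≤x (close x≈y (½ ℚ.* g) (half-positive 0<g)))

∣∣²-cong : ∀ {z w} → z ≈ℂ w → ∣ z ∣² ≈ℝ ∣ w ∣²
∣∣²-cong p = +ℝ-cong (*ℝ-cong (re-≈ p) (re-≈ p)) (*ℝ-cong (im-≈ p) (im-≈ p))

conj-cong : ∀ {z w} → z ≈ℂ w → conj z ≈ℂ conj w
conj-cong p = mk≈ℂ (re-≈ p) (-ℝ-cong (im-≈ p))

boundedℂ-≈ : ∀ {A ε z w} → 0ℚ ℚ.< ε → z ≈ℂ w → Boundedℂ z A → Boundedℂ w (A ℚ.+ ε)
boundedℂ-≈ 0<ε z≈w (mkBoundedℂ r i) = mkBoundedℂ (bounded-≈ 0<ε (re-≈ z≈w) r) (bounded-≈ 0<ε (im-≈ z≈w) i)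

∣∣²-perturb : ∀ a {r r′} → fromℚ r <ℝ ∣ a ∣² → r′ ℚ.< r →
              ∃ λ η → 0ℚ ℚ.< η × (∀ b → Boundedℂ (b -ℂ a) η → fromℚ r′ <ℝ ∣ b ∣²)
∣∣²-perturb a {r} {r′} (mk< g 0<g r+g≤) r′<r = η , 0<η , λ b (mkBoundedℂ hr hi) → mk< g 0<g
  (eventually₂ (λ n p q → estimate (seq (re a) n) (seq (im a) n) (seq (re b) n) (seq (im b) n) p q)
    r+g≤ (eventually₂ (λ n p q → p , q)
      (Bounded.eventually-≤ (bounded-* aᵣ≤ hr)) (Bounded.eventually-≤ (bounded-* aᵢ≤ hi))))
  where
  Bᵣ Bᵢ : ℚ
  Bᵣ = proj₁ (∃-bound (re a))
  Bᵢ = proj₁ (∃-bound (im a))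

  aᵣ≤ : Bounded (re a) Bᵣ
  aᵣ≤ = proj₂ (proj₂ (∃-bound (re a)))

  aᵢ≤ : Bounded (im a) Bᵢ
  aᵢ≤ = proj₂ (proj₂ (∃-bound (im a)))

  -- The cross term 2 Re(ā (b - a)) is at most C η in size. With C η = r - r′ the gap g survives in
  -- full.
  C : ℚ
  C = (Bᵣ ℚ.+ Bᵣ) ℚ.+ (Bᵢ ℚ.+ Bᵢ)

  0<C : 0ℚ ℚ.< C
  0<C = ℚ.+-mono-< (ℚ.+-mono-< 0<Bᵣ 0<Bᵣ) (ℚ.+-mono-< 0<Bᵢ 0<Bᵢ)
    where
    0<Bᵣ = proj₁ (proj₂ (∃-bound (re a)))
    0<Bᵢ = proj₁ (proj₂ (∃-bound (im a)))

  division : ∃ λ η → 0ℚ ℚ.< η × C ℚ.* η ≡ r ℚ.- r′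
  division = ∃-divide 0<C (p<q⇒0<q-p r′<r)

  η : ℚ
  η = proj₁ division

  0<η : 0ℚ ℚ.< η
  0<η = proj₁ (proj₂ division)

  -- |b|² − |a|² ≥ 2 Re(ā (b − a)), the square |b − a|² being dropped.
  estimate : ∀ x y u v → r ℚ.+ g ℚ.≤ x ℚ.* x ℚ.+ y ℚ.* y →
             ∣ x ℚ.* (u ℚ.- x) ∣ ℚ.≤ Bᵣ ℚ.* η × ∣ y ℚ.* (v ℚ.- y) ∣ ℚ.≤ Bᵢ ℚ.* η →
             r′ ℚ.+ g ℚ.≤ u ℚ.* u ℚ.+ v ℚ.* v
  estimate x y u v r+g≤a² (xh≤ , yk≤) = subst₂ ℚ._≤_
    (trans (solve 5 (λ r g e p q → ((r :+ g) :- (p :* e :+ q :* e)) :- (p :* e :+ q :* e) :+ con 0ℚ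
                                     := (r :+ g) :- ((p :+ p) :+ (q :+ q)) :* e) refl r g η Bᵣ Bᵢ)
      (trans (cong (λ t → (r ℚ.+ g) ℚ.- t) (proj₂ (proj₂ division)))
        (solve 3 (λ r s g → (r :+ g) :- (r :- s) := s :+ g) refl r r′ g)))
    (solve 4 (λ x y u v →
       (((x :* x :+ y :* y) :+ (x :* (u :- x) :+ y :* (v :- y))) :+ (x :* (u :- x) :+ y :* (v :- y)))
         :+ ((u :- x) :* (u :- x) :+ (v :- y) :* (v :- y)) := u :* u :+ v :* v) refl x y u v)
    (ℚ.+-mono-≤ (ℚ.+-mono-≤ (ℚ.+-mono-≤ r+g≤a² inner) inner)
      (ℚ.+-mono-≤ (0≤p*p (u ℚ.- x)) (0≤p*p (v ℚ.- y))))
    where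
    lower : ∀ t {B} → ∣ t ∣ ℚ.≤ B → ℚ.- B ℚ.≤ t
    lower t {B} t≤B = subst (ℚ.- B ℚ.≤_) (solve 1 (λ t → :- (:- t) := t) refl t)
      (ℚ.neg-antimono-≤ (ℚ.≤-trans (-p≤∣p∣ t) t≤B))

    inner : ℚ.- (Bᵣ ℚ.* η ℚ.+ Bᵢ ℚ.* η) ℚ.≤ x ℚ.* (u ℚ.- x) ℚ.+ y ℚ.* (v ℚ.- y)
    inner = subst (ℚ._≤ _) (sym (ℚ.neg-distrib-+ (Bᵣ ℚ.* η) (Bᵢ ℚ.* η)))
      (ℚ.+-mono-≤ (lower _ xh≤) (lower _ yk≤))

-- Finite sums

-- The value is ε / 2^d, the same for all d summands; halving fits the recursion of the sum, where
-- the head may use one half and the rest the other.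
tolerance : ℕ → ℚ → ℚ
tolerance zero    ε = ε
tolerance (suc d) ε = tolerance d (½ ℚ.* ε)

tolerance-positive : ∀ d {ε} → 0ℚ ℚ.< ε → 0ℚ ℚ.< tolerance d ε
tolerance-positive zero    0<ε = 0<ε
tolerance-positive (suc d) 0<ε = tolerance-positive d (half-positive 0<ε)

tolerance≤ : ∀ d {ε} → 0ℚ ℚ.< ε → tolerance d ε ℚ.≤ ε
tolerance≤ zero    0<ε = ℚ.≤-refl
tolerance≤ (suc d) 0<ε = ℚ.≤-trans (tolerance≤ d (half-positive 0<ε)) (half≤ 0<ε)

sum-close : ∀ {d ε} → 0ℚ ℚ.< ε → (f g : Fin d → ℂ) →
            (∀ j → Boundedℂ (f j -ℂ g j) (tolerance d ε)) → Boundedℂ (sumℂ f -ℂ sumℂ g) ε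
sum-close {zero}  0<ε f g near = mkBoundedℂ (mkBounded (0 , λ _ _ → ℚ.<⇒≤ 0<ε)) (mkBounded (0 , λ _ _ → ℚ.<⇒≤ 0<ε))
sum-close {suc d} {ε} 0<ε f g near = mkBoundedℂ
  (add-bounds re (re-bounded head) (re-bounded rest)
    (λ a b c e n → rearrange (seq (re a) n) (seq (re b) n) (seq (re c) n) (seq (re e) n)))
  (add-bounds im (im-bounded head) (im-bounded rest)
    (λ a b c e n → rearrange (seq (im a) n) (seq (im b) n) (seq (im c) n) (seq (im e) n)))
  where
  rearrange : ∀ a b c e → (a ℚ.- b) ℚ.+ (c ℚ.- e) ≡ (a ℚ.+ c) ℚ.- (b ℚ.+ e)
  rearrange = solve 4 (λ a b c e → (a :- b) :+ (c :- e) := (a :+ c) :- (b :+ e)) refl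

  head : Boundedℂ (f zero -ℂ g zero) (½ ℚ.* ε)
  head = mkBoundedℂ (bounded-mono (tolerance≤ d (half-positive 0<ε)) (re-bounded (near zero)))
                    (bounded-mono (tolerance≤ d (half-positive 0<ε)) (im-bounded (near zero)))

  rest : Boundedℂ (sumℂ (f ∘ suc) -ℂ sumℂ (g ∘ suc)) (½ ℚ.* ε)
  rest = sum-close (half-positive 0<ε) (f ∘ suc) (g ∘ suc) (near ∘ suc)

  add-bounds : (p : ℂ → ℝ) →
    Bounded (p (f zero -ℂ g zero)) (½ ℚ.* ε) → Bounded (p (sumℂ (f ∘ suc) -ℂ sumℂ (g ∘ suc))) (½ ℚ.* ε) →
    (∀ (a b c e : ℂ) n → seq (p (a -ℂ b)) n ℚ.+ seq (p (c -ℂ e)) n ≡ seq (p ((a +ℂ c) -ℂ (b +ℂ e))) n) →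
    Bounded (p (sumℂ f -ℂ sumℂ g)) ε
  add-bounds p h t eq = subst (Bounded _) (half+half ε)
    (bounded-termwise (eq (f zero) (g zero) (sumℂ (f ∘ suc)) (sumℂ (g ∘ suc))) (bounded-+ h t))

δ : ∀ {d} → Fin d → Fin d → ℂ
δ i j = if does (i Fin.≟ j) then 1ℂ else 0ℂ

sum-zero : ∀ {d} (f : Fin d → ℂ) → (∀ i → f i ≈ℂ 0ℂ) → sumℂ f ≈ℂ 0ℂ
sum-zero {d} f f≈0 = ℂR.trans (sum-cong-≋ f≈0) (sum-replicate-zero d)

sum-δ : ∀ {d} (c : Fin d → ℂ) j → sumℂ (λ i → c i *ℂ δ j i) ≈ℂ c j
sum-δ c zero    = ℂR.trans (ℂR.+-cong (ℂR.*-identityʳ (c zero)) (sum-zero _ (λ i → ℂR.zeroʳ (c (suc i)))))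
                           (ℂR.+-identityʳ (c zero))
sum-δ c (suc j) = ℂR.trans (ℂR.+-cong (ℂR.zeroʳ (c zero)) (sum-δ (c ∘ suc) j)) (ℂR.+-identityˡ (c (suc j)))

-- Each term of the sequence is an exact sum of rational squares, so no ε is lost. Both claims go
-- through one induction, because dropping the rest of the sum requires its non-negativity.
∣∣²≤sum : ∀ {d} (f : Fin d → ℂ) n →
          0ℚ ℚ.≤ seq (re (sumℂ (λ j → f j *ℂ conj (f j)))) n ×
          (∀ j → seq (∣ f j ∣²) n ℚ.≤ seq (re (sumℂ (λ j → f j *ℂ conj (f j)))) n)
∣∣²≤sum {zero}  f n = ℚ.≤-refl , λ ()
∣∣²≤sum {suc d} f n = ℚ.+-mono-≤ 0≤head 0≤rest , λ
  { zero    → ℚ.≤-trans (ℚ.≤-reflexive (sym head≡)) (p≤p+q 0≤rest)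
  ; (suc j) → ℚ.≤-trans (rest≥ j) (p≤q+p 0≤head) }
  where
  0≤rest = proj₁ (∣∣²≤sum (f ∘ suc) n)
  rest≥  = proj₂ (∣∣²≤sum (f ∘ suc) n)
  a = seq (re (f zero)) n
  b = seq (im (f zero)) n
  head≡ : a ℚ.* a ℚ.+ ℚ.- (b ℚ.* (ℚ.- b)) ≡ a ℚ.* a ℚ.+ b ℚ.* b
  head≡ = solve 2 (λ a b → a :* a :+ :- (b :* (:- b)) := a :* a :+ b :* b) refl a b
  0≤head : 0ℚ ℚ.≤ a ℚ.* a ℚ.+ ℚ.- (b ℚ.* (ℚ.- b))
  0≤head = subst (0ℚ ℚ.≤_) (sym head≡) (ℚ.+-mono-≤ (0≤p*p a) (0≤p*p b))

-- Orthonormal expansions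

module Expansion (H : HilbertSpace) where
  open HilbertSpace H

  coordinates : Carrierᴹ → Fin dim → ℂ
  coordinates x j = ⟨ basis j ∣ x ⟩

  ⟨∣⟩-0ʳ : ∀ x → ⟨ x ∣ 0ᴹ ⟩ ≈ℂ 0ℂ
  ⟨∣⟩-0ʳ x = begin
    ⟨ x ∣ 0ᴹ ⟩          ≈⟨ ⟨∣⟩-cong ≈ᴹ-refl (≈ᴹ-sym (*ₗ-zeroˡ 0ᴹ)) ⟩
    ⟨ x ∣ 0ℂ *ₗ 0ᴹ ⟩    ≈⟨ ⟨∣⟩-*ʳ 0ℂ x 0ᴹ ⟩
    0ℂ *ℂ ⟨ x ∣ 0ᴹ ⟩    ≈⟨ ℂR.zeroˡ _ ⟩
    0ℂ                  ∎
    where open SetoidReasoning ℂR.setoid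

  ⟨∣⟩-sumʳ : ∀ {d} x (v : Fin d → Carrierᴹ) → ⟨ x ∣ sum v ⟩ ≈ℂ sumℂ (λ i → ⟨ x ∣ v i ⟩)
  ⟨∣⟩-sumʳ {zero}  x v = ⟨∣⟩-0ʳ x
  ⟨∣⟩-sumʳ {suc d} x v = ℂR.trans (⟨∣⟩-+ʳ x (v zero) (sum (v ∘ suc))) (ℂR.+-congˡ (⟨∣⟩-sumʳ x (v ∘ suc)))

  ⟨∣⟩-combination : ∀ x (c : Fin dim → ℂ) → ⟨ x ∣ sum (λ i → c i *ₗ basis i) ⟩ ≈ℂ sumℂ (λ i → c i *ℂ ⟨ x ∣ basis i ⟩)
  ⟨∣⟩-combination x c = ℂR.trans (⟨∣⟩-sumʳ x (λ i → c i *ₗ basis i)) (sum-cong-≋ (λ i → ⟨∣⟩-*ʳ (c i) x (basis i)))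

  -- `spanning` yields merely some coefficients of y; orthonormality identifies them with inner
  -- products.
  parseval : ∀ x y → ⟨ x ∣ y ⟩ ≈ℂ sumℂ (λ j → coordinates y j *ℂ conj (coordinates x j))
  parseval x y = begin
    ⟨ x ∣ y ⟩                                             ≈⟨ ⟨∣⟩-cong ≈ᴹ-refl y≈ ⟩
    ⟨ x ∣ sum (λ i → c i *ₗ basis i) ⟩                     ≈⟨ ⟨∣⟩-combination x c ⟩
    sumℂ (λ i → c i *ℂ ⟨ x ∣ basis i ⟩)                    ≈⟨ sum-cong-≋ (λ i → ℂR.*-cong (coefficient i) (⟨∣⟩-conj x (basis i))) ⟩
    sumℂ (λ j → coordinates y j *ℂ conj (coordinates x j)) ∎
    where
    open SetoidReasoning ℂR.setoid
    c = proj₁ (spanning y)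
    y≈ = proj₂ (spanning y)
    coefficient : ∀ j → c j ≈ℂ ⟨ basis j ∣ y ⟩
    coefficient j = begin
      c j                                          ≈⟨ ℂR.sym (sum-δ c j) ⟩
      sumℂ (λ i → c i *ℂ δ j i)                     ≈⟨ sum-cong-≋ (λ i → ℂR.*-congˡ {c i} (ℂR.sym (orthonormal j i))) ⟩
      sumℂ (λ i → c i *ℂ ⟨ basis j ∣ basis i ⟩)     ≈⟨ ℂR.sym (⟨∣⟩-combination (basis j) c) ⟩
      ⟨ basis j ∣ sum (λ i → c i *ₗ basis i) ⟩      ≈⟨ ⟨∣⟩-cong ≈ᴹ-refl (≈ᴹ-sym y≈) ⟩
      ⟨ basis j ∣ y ⟩                              ∎

  -- The norm equals one only up to an error, which is taken to be 1. Hence squares are eventually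
  -- at most 2, and 2 < 2 · 2 bounds the parts by 2.
  coordinates-bounded : ∀ x → IsUnit x → ∀ j → Boundedℂ (coordinates x j) 2ℚ
  coordinates-bounded x x-unit j = mkBoundedℂ
    (mkBounded (eventually (λ n p → root (seq (re z) n) (ℚ.≤-trans (p≤p+q (0≤p*p (seq (im z) n))) (∣z∣²≤2 n p))) norm≤2))
    (mkBounded (eventually (λ n p → root (seq (im z) n) (ℚ.≤-trans (p≤q+p (0≤p*p (seq (re z) n))) (∣z∣²≤2 n p))) norm≤2))
    where
    z : ℂ
    z = coordinates x j

    norm : ℝ
    norm = re (sumℂ (λ j → coordinates x j *ℂ conj (coordinates x j)))

    norm≤2 : Eventually (λ n → ∣ seq norm n ∣ ℚ.≤ 2ℚ)
    norm≤2 = Bounded.eventually-≤ (bounded-≈ {x = 1ℝ} {A = 1ℚ} {ε = 1ℚ} (ℚ.positive⁻¹ 1ℚ)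
      (re-≈ (ℂR.trans (ℂR.sym x-unit) (parseval x x))) (mkBounded (0 , λ _ _ → ℚ.≤-refl)))

    ∣z∣²≤2 : ∀ n → ∣ seq norm n ∣ ℚ.≤ 2ℚ → seq ∣ z ∣² n ℚ.≤ 2ℚ
    ∣z∣²≤2 n p = ℚ.≤-trans (proj₂ (∣∣²≤sum (coordinates x) n) j) (ℚ.≤-trans (p≤∣p∣ (seq norm n)) p)

    root : ∀ q → q ℚ.* q ℚ.≤ 2ℚ → ∣ q ∣ ℚ.≤ 2ℚ
    root q q²≤2 with ∣ q ∣ ℚ.≤? 2ℚ
    ... | yes p = p
    ... | no ¬p = contradiction 4≤2 (toWitnessFalse {a? = 2ℚ ℚ.* 2ℚ ℚ.≤? 2ℚ} _)
      where
      2≤ : 2ℚ ℚ.≤ ∣ q ∣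
      2≤ = ℚ.<⇒≤ (ℚ.≰⇒> ¬p)
      4≤2 : 2ℚ ℚ.* 2ℚ ℚ.≤ 2ℚ
      4≤2 = ℚ.≤-trans (*-mono-≤-nonNeg (ℚ.nonNegative⁻¹ 2ℚ) (ℚ.nonNegative⁻¹ 2ℚ) 2≤ 2≤)
                      (subst (ℚ._≤ 2ℚ) (sym (∣p∣*∣p∣ q)) q²≤2)

-- Recurrence of unitary orbits

module Evolution {k} (A : QuantumAutomaton k) where
  open QuantumAutomaton A
  open Expansion H

  evolve : ωWord k → ℕ → Carrierᴹ → Carrierᴹ
  evolve w zero    x = x
  evolve w (suc n) x = U (w n) (evolve w n x)

  evolve-+ : ∀ w m n x → evolve w (m ℕ.+ n) x ≡ evolve (dropω m w) n (evolve w m x)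
  evolve-+ w m zero    x = cong (λ l → evolve w l x) (ℕ.+-identityʳ m)
  evolve-+ w m (suc n) x = trans (cong (λ l → evolve w l x) (ℕ.+-suc m n)) (cong (U (w (m ℕ.+ n))) (evolve-+ w m n x))

  evolve-cong : ∀ {w w′} n x → (∀ i → i ℕ.< n → w i ≡ w′ i) → evolve w n x ≡ evolve w′ n x
  evolve-cong zero    x eq = refl
  evolve-cong (suc n) x eq = cong₂ U (eq n ℕ.≤-refl) (evolve-cong n x (λ i i<n → eq i (ℕ.m<n⇒m<1+n i<n)))

  evolve† : ωWord k → ℕ → Carrierᴹ → Carrierᴹ
  evolve† w zero    x = x
  evolve† w (suc n) x = evolve† w n (IsUnitary._† (U-unitary (w n)) x)

  evolve†-adjoint : ∀ w n x y → ⟨ evolve† w n x ∣ y ⟩ ≈ℂ ⟨ x ∣ evolve w n y ⟩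
  evolve†-adjoint w zero    x y = ℂR.refl
  evolve†-adjoint w (suc n) x y =
    ℂR.trans (evolve†-adjoint w n _ y) (IsUnitary.isAdjoint (U-unitary (w n)) x (evolve w n y))

  evolve†-unit : ∀ w n x → IsUnit x → IsUnit (evolve† w n x)
  evolve†-unit w zero    x x-unit = x-unit
  evolve†-unit w (suc n) x x-unit = evolve†-unit w n (x †)
    (ℂR.trans (isAdjoint x (x †)) (ℂR.trans (⟨∣⟩-cong ≈ᴹ-refl (inverseʳ x)) x-unit))
    where open IsUnitary (U-unitary (w n))

  evolve-isometry : ∀ w n x y → ⟨ evolve w n x ∣ evolve w n y ⟩ ≈ℂ ⟨ x ∣ y ⟩
  evolve-isometry w zero    x y = ℂR.refl
  evolve-isometry w (suc n) x y = ℂR.trans (ℂR.sym (isAdjoint _ _))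
    (ℂR.trans (⟨∣⟩-cong (inverseˡ _) ≈ᴹ-refl) (evolve-isometry w n x y))
    where open IsUnitary (U-unitary (w n))

  -- If the states after i and i′ steps are close, then so are ⟨Uⁱφ|Uⁱ′s⟩ and ⟨Uⁱφ|Uⁱs⟩, and the
  -- isometry Uⁱ cancels from both. Moving φ along avoids inverting U.
  recurrence : ∀ (a : Fin k) φ s → IsUnit φ → IsUnit s → ∀ {η} → 0ℚ ℚ.< η →
               ∃ λ m → Boundedℂ (⟨ φ ∣ evolve (constω a) (suc m) s ⟩ -ℂ ⟨ φ ∣ s ⟩) η
  recurrence a φ s φ-unit s-unit {η} 0<η = return (close-pair (half-positive (half-positive 0<ρ)) orbit orbit≤2)
    where
    -- Half of η is for the sum over coordinates, half for the passage to inner products. The orbit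
    -- is matched within ρ / 4, since a factor with parts bounded by 2 multiplies the error by 2 +
    -- 2.
    ρ : ℚ
    ρ = tolerance dim (½ ℚ.* η)

    0<ρ : 0ℚ ℚ.< ρ
    0<ρ = tolerance-positive dim (half-positive 0<η)

    power : ℕ → Carrierᴹ → Carrierᴹ
    power = evolve (constω a)

    orbit : ℕ → Fin dim → ℂ
    orbit i = coordinates (power i s)

    power-unit : ∀ i x → IsUnit x → IsUnit (power i x)
    power-unit i x x-unit = ℂR.trans (evolve-isometry (constω a) i x x) x-unit

    orbit≤2 : ∀ i j → Boundedℂ (orbit i j) 2ℚ
    orbit≤2 i = coordinates-bounded (power i s) (power-unit i s s-unit)

    conj-bounded : ∀ {B z} → Boundedℂ z B → Boundedℂ (conj z) B
    conj-bounded (mkBoundedℂ r i) = mkBoundedℂ r (bounded-neg i)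

    distribute : ∀ {B} x y z → Boundedℂ ((x -ℂ y) *ℂ z) B → Boundedℂ ((x *ℂ z) -ℂ (y *ℂ z)) B
    distribute x y z (mkBoundedℂ r i) = mkBoundedℂ
      (bounded-termwise
        (λ n → solve 6 (λ xr xi yr yi zr zi → (xr :- yr) :* zr :+ :- ((xi :- yi) :* zi)
                 := (xr :* zr :+ :- (xi :* zi)) :- (yr :* zr :+ :- (yi :* zi))) refl
                 (seq (re x) n) (seq (im x) n) (seq (re y) n) (seq (im y) n) (seq (re z) n) (seq (im z) n)) r)
      (bounded-termwise
        (λ n → solve 6 (λ xr xi yr yi zr zi → (xr :- yr) :* zi :+ (xi :- yi) :* zr
                 := (xr :* zi :+ xi :* zr) :- (yr :* zi :+ yi :* zr)) refl
                 (seq (re x) n) (seq (im x) n) (seq (re y) n) (seq (im y) n) (seq (re z) n) (seq (im z) n)) i)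

    ρ-eq : ½ ℚ.* (½ ℚ.* ρ) ℚ.* 2ℚ ℚ.+ ½ ℚ.* (½ ℚ.* ρ) ℚ.* 2ℚ ≡ ρ
    ρ-eq = solve 1 (λ r → con ½ :* (con ½ :* r) :* con 2ℚ :+ con ½ :* (con ½ :* r) :* con 2ℚ := r) refl ρ

    return : (∃₂ λ i i′ → i ℕ.< i′ × (∀ j → Boundedℂ (orbit i′ j -ℂ orbit i j) (½ ℚ.* (½ ℚ.* ρ)))) →
             ∃ λ m → Boundedℂ (⟨ φ ∣ power (suc m) s ⟩ -ℂ ⟨ φ ∣ s ⟩) η
    return (i , i′ , i<i′ , near) = m ,
      subst (Boundedℂ _) (half+half η) (boundedℂ-≈ (half-positive 0<η)
        (ℂR.+-cong (ℂR.sym expand-later) (ℂR.-‿cong (ℂR.sym expand-now)))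
        (sum-close (half-positive 0<η) _ _ λ j → distribute (orbit i′ j) (orbit i j) (conj (α j))
          (subst (Boundedℂ _) ρ-eq (boundedℂ-* (near j) (conj-bounded (α≤2 j))))))
      where
      -- The return time `suc m` is i′ - i. It has to be positive so that the inserted word really
      -- begins with the letter.
      m : ℕ
      m = i′ ℕ.∸ suc i

      i′≡ : suc m ℕ.+ i ≡ i′
      i′≡ = trans (sym (ℕ.+-suc m i)) (ℕ.m∸n+n≡m i<i′)

      α : Fin dim → ℂ
      α = coordinates (power i φ)

      α≤2 : ∀ j → Boundedℂ (α j) 2ℚ
      α≤2 = coordinates-bounded (power i φ) (power-unit i φ φ-unit)

      expand-now : ⟨ φ ∣ s ⟩ ≈ℂ sumℂ (λ j → orbit i j *ℂ conj (α j))
      expand-now = ℂR.trans (ℂR.sym (evolve-isometry (constω a) i φ s)) (parseval (power i φ) (power i s))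

      expand-later : ⟨ φ ∣ power (suc m) s ⟩ ≈ℂ sumℂ (λ j → orbit i′ j *ℂ conj (α j))
      expand-later = ℂR.trans (ℂR.sym (evolve-isometry (constω a) i φ (power (suc m) s)))
        (subst (λ v → ⟨ power i φ ∣ v ⟩ ≈ℂ sumℂ (λ j → orbit i′ j *ℂ conj (α j)))
          (trans (cong (λ l → power l s) (sym i′≡)) (evolve-+ (constω a) (suc m) i s))
          (parseval (power i φ) (power i′ s)))

  -- Insertion of an unused letter

  delay : ℕ → Checkpoints → Checkpoints
  delay m c = record { at = λ i → m ℕ.+ at c i ; increasing = λ i → ℕ.+-monoʳ-< m (increasing c i) }

  at-0-least : ∀ c i → at c 0 ℕ.≤ at c i
  at-0-least c zero    = ℕ.≤-refl
  at-0-least c (suc i) = ℕ.≤-trans (at-0-least c i) (ℕ.<⇒≤ (increasing c i))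

  at-0-first : ∀ c i → at c 0 ℕ.< at c (suc i)
  at-0-first c i = ℕ.≤-<-trans (at-0-least c i) (increasing c i)

  -- A reset acts on the state after its checkpoint, so the first checkpoint itself is still
  -- included.
  run-before : ∀ w ψ c n → n ℕ.≤ at c 0 → run A w ψ c n ≡ evolve w n s₀
  run-before w ψ c zero    n≤ = refl
  run-before w ψ c (suc n) n≤ = cong (U (w n)) (trans
    (cong (λ b → if b then ψ else run A w ψ c n)
      (dec-false (isCheckpoint? c n) λ { (i , eq) → ℕ.<⇒≱ n≤ (subst (at c 0 ℕ.≤_) eq (at-0-least c i)) }))
    (run-before w ψ c n (ℕ.<⇒≤ n≤)))

  -- Unwinding the run stops at the latest at the first checkpoint, where both runs are replaced by
  -- ψ and forget what was read before. Hence the strict inequality.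
  run-after : ∀ w w′ ψ c m → dropω m w′ ≗ w → ∀ n → at c 0 ℕ.< n →
              run A w′ ψ (delay m c) (m ℕ.+ n) ≡ run A w ψ c n
  run-after w w′ ψ c m w′≗w (suc n) (s≤s at≤n) = trans (cong (run A w′ ψ (delay m c)) (ℕ.+-suc m n))
    (cong₂ U (w′≗w n) (trans
      (cong (λ b → if b then ψ else run A w′ ψ (delay m c) (m ℕ.+ n))
        (does-⇔ (mk⇔ (λ { (i , eq) → i , ℕ.+-cancelˡ-≡ m _ _ eq }) (λ { (i , eq) → i , cong (m ℕ.+_) eq }))
          (isCheckpoint? (delay m c) (m ℕ.+ n)) (isCheckpoint? c n)))
      (same (isCheckpoint? c n))))
    where
    same : (checkpoint? : Dec (∃ λ i → at c i ≡ n)) →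
           (if does checkpoint? then ψ else run A w′ ψ (delay m c) (m ℕ.+ n)) ≡
           (if does checkpoint? then ψ else run A w ψ c n)
    same (yes _) = refl
    same (no ¬c) = run-after w w′ ψ c m w′≗w n (ℕ.≤∧≢⇒< at≤n (λ eq → ¬c (0 , eq)))

  module _ (a : Fin k) (w : ωWord k) (m : ℕ) where

    private
      w′ : ωWord k
      w′ = replicate (suc m) a ++ω w

      w′-drop : dropω (suc m) w′ ≗ w
      w′-drop i = trans (cong (λ l → w′ (l ℕ.+ i)) (sym (length-replicate (suc m))))
                        (++ω-drop (replicate (suc m) a) w i)

      replicate-start : ∀ l i → i ℕ.< l → (replicate l a ++ω w) i ≡ a
      replicate-start (suc l) zero    _         = refl
      replicate-start (suc l) (suc i) (s≤s i<l) = replicate-start l i i<l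

      first : ∀ ψ c → run A w′ ψ (delay (suc m) c) (suc m ℕ.+ at c 0) ≡
                      evolve w (at c 0) (evolve (constω a) (suc m) s₀)
      first ψ c = begin
        run A w′ ψ (delay (suc m) c) (suc m ℕ.+ at c 0)
          ≡⟨ run-before w′ ψ (delay (suc m) c) (suc m ℕ.+ at c 0) ℕ.≤-refl ⟩
        evolve w′ (suc m ℕ.+ at c 0) s₀
          ≡⟨ evolve-+ w′ (suc m) (at c 0) s₀ ⟩
        evolve (dropω (suc m) w′) (at c 0) (evolve w′ (suc m) s₀)
          ≡⟨ evolve-cong (at c 0) _ (λ i _ → w′-drop i) ⟩
        evolve w (at c 0) (evolve w′ (suc m) s₀)
          ≡⟨ cong (evolve w (at c 0)) (evolve-cong (suc m) s₀ (replicate-start (suc m))) ⟩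
        evolve w (at c 0) (evolve (constω a) (suc m) s₀) ∎
        where open ≡-Reasoning

    run-delayed : ∀ ψ c {r} →
      fromℚ r <ℝ ∣ ⟨ ψ ∣ evolve w (at c 0) (evolve (constω a) (suc m) s₀) ⟩ ∣² →
      (∀ i → fromℚ r <ℝ ∣ ⟨ ψ ∣ run A w ψ c (at c i) ⟩ ∣²) →
      ∀ i → fromℚ r <ℝ ∣ ⟨ ψ ∣ run A w′ ψ (delay (suc m) c) (suc m ℕ.+ at c i) ⟩ ∣²
    run-delayed ψ c {r} r<first r< zero    =
      subst (λ v → fromℚ r <ℝ ∣ ⟨ ψ ∣ v ⟩ ∣²) (sym (first ψ c)) r<first
    run-delayed ψ c {r} r<first r< (suc i) =
      subst (λ v → fromℚ r <ℝ ∣ ⟨ ψ ∣ v ⟩ ∣²)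
        (sym (run-after w w′ ψ c (suc m) w′-drop (at c (suc i)) (at-0-first c i))) (r< (suc i))

  -- The infimum leaves room between q and r. An r′ in between absorbs the loss of the first
  -- fidelity, while the later fidelities still exceed r. The vector φ is ψ pulled back to time 0,
  -- so it does not depend on m.
  insertion : ∀ (a : Fin k) {λ₀ w} → (L^> A) λ₀ w → ∃ λ m → (L^> A) λ₀ (replicate (suc m) a ++ω w)
  insertion a {λ₀} {w} (q , λ₀<q , (ψ , ψ∈F , ψ-unit) , c , r , q<r , r<) = relax (ℚ.<-dense q<r)
    where
    φ : Carrierᴹ
    φ = evolve† w (at c 0) ψ

    φ-value : fromℚ r <ℝ ∣ ⟨ φ ∣ s₀ ⟩ ∣²
    φ-value = <ℝ-resp-≈ (subst (λ v → fromℚ r <ℝ ∣ ⟨ ψ ∣ v ⟩ ∣²) (run-before w ψ c (at c 0) ℕ.≤-refl) (r< 0))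
                        (∣∣²-cong (ℂR.sym (evolve†-adjoint w (at c 0) ψ s₀)))

    Goal : Set
    Goal = ∃ λ m → (L^> A) λ₀ (replicate (suc m) a ++ω w)

    return : ∀ {r′ η} → q ℚ.< r′ → r′ ℚ.< r →
             (∀ b → Boundedℂ (b -ℂ ⟨ φ ∣ s₀ ⟩) η → fromℚ r′ <ℝ ∣ b ∣²) →
             (∃ λ m → Boundedℂ (⟨ φ ∣ evolve (constω a) (suc m) s₀ ⟩ -ℂ ⟨ φ ∣ s₀ ⟩) η) → Goal
    return {r′} q<r′ r′<r stable (m , near) = m ,
      q , λ₀<q , (ψ , ψ∈F , ψ-unit) , delay (suc m) c , r′ , q<r′ ,
      run-delayed a w m ψ c
        (<ℝ-resp-≈ (stable _ near) (∣∣²-cong (evolve†-adjoint w (at c 0) ψ _)))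
        (λ i → downClosed (fromℝ _) r′<r (r< i))

    perturb : ∀ {r′} → q ℚ.< r′ → r′ ℚ.< r →
              (∃ λ η → 0ℚ ℚ.< η × (∀ b → Boundedℂ (b -ℂ ⟨ φ ∣ s₀ ⟩) η → fromℚ r′ <ℝ ∣ b ∣²)) → Goal
    perturb q<r′ r′<r (η , 0<η , stable) = return q<r′ r′<r stable
      (recurrence a φ s₀ (evolve†-unit w (at c 0) ψ ψ-unit) s₀-unit 0<η)

    relax : (∃ λ r′ → q ℚ.< r′ × r′ ℚ.< r) → Goal
    relax (r′ , q<r′ , r′<r) = perturb q<r′ r′<r (∣∣²-perturb ⟨ φ ∣ s₀ ⟩ φ-value r′<r)

unused-letter : ∀ {k} {L : Pred (ωWord k) _} {λ₀ w} (a : Fin k) → w ∈ L → (∀ {x} → x ∈ L → x 0 ≢ a) →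
                (k , L) ∉ 𝕃^> λ₀
unused-letter {λ₀ = λ₀} {w} a w∈L unused (A , L⊆ , ⊆L) =
  unused (⊆L (proj₂ inserted)) refl
  where
  inserted : ∃ λ m → (L^> A) λ₀ (replicate (suc m) a ++ω w)
  inserted = Evolution.insertion A a (L⊆ w∈L)

-- Languages with an unused letter

constω-^ω : ∀ {k} (V : Language k) {c} → (c ∷ []) ∈ V → (V ^ω) (constω c)
constω-^ω V {c} c∈V = (λ _ → c ∷ []) , (λ _ → c∈V , λ ()) , prefixes
  where
  prefixes : ∀ n → concat (applyUpTo (λ _ → c ∷ []) n) IsPrefixOf constω c
  prefixes zero    = refl
  prefixes (suc n) = cong (c ∷_) (prefixes n)

·-refl : ∀ {k} {U : Language k} {X : Pred (ωWord k) _} {u x} → u ∈ U → x ∈ X → (u ++ω x) ∈ U · X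
·-refl {u = u} {x} u∈ x∈ = u , x , u∈ , x∈ , λ _ → refl

-- States and letters are both `Fin 2`: in the live state the letter read is itself the next state,
-- and 1 is the dead state.
zeros : DFA 2
zeros = record { states = 2 ; initial = zero ; step = step ; accepting = ⁅ zero ⁆ }
  where
  step : Fin 2 → Fin 2 → Fin 2
  step zero    a = a
  step (suc q) a = suc zero

zeros-head : ∀ {a u} → (a ∷ u) ∈ DFA.Accepts zeros → a ≢ suc zero
zeros-head {u = u} au∈ refl = contradiction (trans (sym (sink u)) (x∈⁅y⁆⇒x≡y zero au∈)) λ ()
  where
  sink : ∀ u → foldl (DFA.step zeros) (suc zero) u ≡ suc zero
  sink []      = refl
  sink (a ∷ u) = sink u

-- This is {0^ω}, written as 0*(0*)^ω. The index in `Fin 1` gives it the shape of `ωClosure`, so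
-- that its membership in `ω-RL` is shown by identities.
zerosω : Pred (ωWord 2) _
zerosω w = ∃ λ (i : Fin 1) → w ∈ DFA.Accepts zeros · (DFA.Accepts zeros ^ω)

zerosω∈ω-RL : (2 , zerosω) ∈ ω-RL
zerosω∈ω-RL = 1 , (λ _ → DFA.Accepts zeros) , (λ _ → DFA.Accepts zeros) ,
  (λ _ → (zeros , (λ u∈ → u∈) , (λ u∈ → u∈)) , (zeros , (λ u∈ → u∈) , (λ u∈ → u∈))) , (λ w∈ → w∈) , (λ w∈ → w∈)

zerosω-inhabited : constω zero ∈ zerosω
zerosω-inhabited = zero , ·-refl {U = DFA.Accepts zeros} {u = []} (x∈⁅x⁆ zero) (constω-^ω (DFA.Accepts zeros) (x∈⁅x⁆ zero))

zerosω-unused : ∀ {x} → x ∈ zerosω → x 0 ≢ suc zero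
zerosω-unused (_ , a ∷ u , y , u∈ , y∈ , x≗) x0≡1 = zeros-head {u = u} u∈ (trans (sym (x≗ 0)) x0≡1)
zerosω-unused (_ , [] , y , _ , y∈ , x≗) x0≡1 with ^ω-uncons {V = DFA.Accepts zeros} y∈
... | [] , z , (_ , ne) , _ = ne refl
... | a ∷ v , z , (v∈ , _) , _ , y≗ = zeros-head {u = v} v∈ (trans (sym (y≗ 0)) (trans (sym (x≗ 0)) x0≡1))

-- The words aⁿbⁿc^ω as an ω-context-free language

pattern a₄ = zero
pattern b₄ = suc zero
pattern c₄ = suc (suc zero)
pattern d₄ = suc (suc (suc zero))

balanced : CFG 4
balanced = record
  { nonterminals = 1
  ; start        = zero
  ; productions  = (zero , inj₂ a₄ ∷ inj₁ zero ∷ inj₂ b₄ ∷ []) ∷ (zero , []) ∷ []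
  }

single : CFG 4
single = record
  { nonterminals = 1
  ; start        = zero
  ; productions  = (zero , inj₂ c₄ ∷ []) ∷ []
  }

module Balanced where
  open CFG balanced

  𝕒 𝕓 𝕊 : Symbol
  𝕒 = inj₂ a₄
  𝕓 = inj₂ b₄
  𝕊 = inj₁ zero

  terminals : List (Fin 4) → List Symbol
  terminals = map inj₂

  replicate-shift : ∀ {X : Set} n (x : X) t → replicate n x ++ x ∷ t ≡ x ∷ replicate n x ++ t
  replicate-shift zero    x t = refl
  replicate-shift (suc n) x t = cong (x ∷_) (replicate-shift n x t)

  form : ℕ → List Symbol
  form n = replicate n 𝕒 ++ 𝕊 ∷ replicate n 𝕓

  word : ℕ → List (Fin 4)
  word n = replicate n a₄ ++ replicate n b₄

  map-word : ∀ n → terminals (word n) ≡ replicate n 𝕒 ++ replicate n 𝕓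
  map-word n = trans (map-++ inj₂ (replicate n a₄) (replicate n b₄))
                     (cong₂ _++_ (map-replicate inj₂ n a₄) (map-replicate inj₂ n b₄))

  form-suc : ∀ n → replicate n 𝕒 ++ (𝕒 ∷ 𝕊 ∷ 𝕓 ∷ []) ++ replicate n 𝕓 ≡ form (suc n)
  form-suc n = replicate-shift n 𝕒 _

  derive-form : ∀ n → Star _⇒_ (𝕊 ∷ []) (form n)
  derive-form zero    = ε⋆
  derive-form (suc n) = derive-form n ◅◅
    subst (form n ⇒_) (form-suc n) (rewriteWith (here refl) (replicate n 𝕒) (replicate n 𝕓)) ◅ ε⋆

  word-generated : ∀ n → word n ∈ Generates
  word-generated n = derive-form n ◅◅
    subst (form n ⇒_) (sym (map-word n)) (rewriteWith (there (here refl)) (replicate n 𝕒) (replicate n 𝕓)) ◅ ε⋆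

  terminal-no-nonterminal : ∀ {X β} α (w : List (Fin 4)) → terminals w ≢ α ++ inj₁ X ∷ β
  terminal-no-nonterminal []      []      ()
  terminal-no-nonterminal []      (x ∷ w) ()
  terminal-no-nonterminal (s ∷ α) (x ∷ w) eq = terminal-no-nonterminal α w (proj₂ (∷-injective eq))

  -- A sentential form with a single nonterminal can be rewritten in one place only.
  split-unique : ∀ {X} α {β} n (w : List (Fin 4)) →
    replicate n 𝕒 ++ 𝕊 ∷ terminals w ≡ α ++ inj₁ X ∷ β →
    α ≡ replicate n 𝕒 × β ≡ terminals w
  split-unique []      zero    w eq = refl , sym (proj₂ (∷-injective eq))
  split-unique []      (suc n) w ()
  split-unique (s ∷ α) zero    w eq = ⊥-elim (terminal-no-nonterminal α w (proj₂ (∷-injective eq)))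
  split-unique (s ∷ α) (suc n) w eq with ∷-injective eq
  ... | s≡ , eq′ with split-unique α n w eq′
  ... | α≡ , β≡ = cong₂ _∷_ (sym s≡) α≡ , β≡

  terminal-stuck : ∀ {γ w} v → Star _⇒_ γ (terminals w) → γ ≡ terminals v → w ≡ v
  terminal-stuck v ε⋆ γ≡ = map-injective inj₂-injective γ≡
  terminal-stuck v (rewriteWith _ α β ◅ _) γ≡ = ⊥-elim (terminal-no-nonterminal α v (sym γ≡))

  map-b : ∀ n → terminals (replicate n b₄) ≡ replicate n 𝕓
  map-b n = map-replicate inj₂ n b₄

  mutual
    -- A derivation step from aⁿSbⁿ either raises n or erases S, after which no step is possible.
    -- The form enters through an equation so that the derivation can be matched at a variable
    -- index.
    form-generates : ∀ n {γ w} → Star _⇒_ γ (terminals w) → γ ≡ form n → ∃ λ l → w ≡ word l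
    form-generates n {w = w} ε⋆ γ≡ = ⊥-elim (terminal-no-nonterminal (replicate n 𝕒) w γ≡)
    form-generates n (rewriteWith p α β ◅ rest) γ≡ = rewritten n p rest
      (split-unique α n (replicate n b₄)
        (trans (cong (λ t → replicate n 𝕒 ++ 𝕊 ∷ t) (map-b n)) (sym γ≡)))

    rewritten : ∀ n {X γ α β w} → (X , γ) ∈ₗ productions → Star _⇒_ (α ++ γ ++ β) (terminals w) →
                α ≡ replicate n 𝕒 × β ≡ terminals (replicate n b₄) → ∃ λ l → w ≡ word l
    rewritten n (here refl) rest (α≡ , β≡) = form-generates (suc n) rest
      (trans (cong₂ (λ α β → α ++ 𝕒 ∷ 𝕊 ∷ 𝕓 ∷ β) α≡ (trans β≡ (map-b n))) (form-suc n))
    rewritten n (there (here refl)) rest (α≡ , β≡) =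
      n , terminal-stuck (word n) rest (trans (cong₂ _++_ α≡ (trans β≡ (map-b n))) (sym (map-word n)))

  generated : ∀ {w} → w ∈ Generates → ∃ λ l → w ≡ word l
  generated w∈ = form-generates 0 w∈ refl

module Single where
  open CFG single

  c-generated : (c₄ ∷ []) ∈ Generates
  c-generated = rewriteWith (here refl) [] [] ◅ ε⋆

  generated : ∀ {w} → w ∈ Generates → w ≡ c₄ ∷ []
  generated w∈ = from-start w∈ refl
    where
    from-c : ∀ {γ w} → Star _⇒_ γ (map inj₂ w) → γ ≡ inj₂ c₄ ∷ [] → w ≡ c₄ ∷ []
    from-c ε⋆ γ≡ = map-injective inj₂-injective γ≡
    from-c (rewriteWith _ [] β ◅ _) ()
    from-c (rewriteWith _ (s ∷ []) β ◅ _) ()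
    from-c (rewriteWith _ (s ∷ t ∷ α) β ◅ _) ()

    from-start : ∀ {γ w} → Star _⇒_ γ (map inj₂ w) → γ ≡ inj₁ zero ∷ [] → w ≡ c₄ ∷ []
    from-start {w = []}    ε⋆ ()
    from-start {w = x ∷ w} ε⋆ ()
    from-start (rewriteWith (here refl) [] [] ◅ rest) γ≡ = from-c rest refl
    from-start (rewriteWith (here refl) [] (s ∷ β) ◅ rest) ()
    from-start (rewriteWith (here refl) (s ∷ []) β ◅ rest) ()
    from-start (rewriteWith (here refl) (s ∷ t ∷ α) β ◅ rest) ()

  ω-generated : ∀ i {x} → (Generates ^ω) x → x i ≡ c₄
  ω-generated i {x} x∈ with ^ω-uncons {V = Generates} x∈
  ... | v , y , (v∈ , _) , y∈ , x≗ with generated v∈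
  ω-generated zero    x∈ | v , y , (v∈ , _) , y∈ , x≗ | refl = x≗ 0
  ω-generated (suc i) x∈ | v , y , (v∈ , _) , y∈ , x≗ | refl = trans (x≗ (suc i)) (ω-generated i y∈)

balancedω : Pred (ωWord 4) _
balancedω w = ∃ λ (i : Fin 1) → w ∈ CFG.Generates balanced · (CFG.Generates single ^ω)

balancedω∈ω-CFL : (4 , balancedω) ∈ ω-CFL
balancedω∈ω-CFL = 1 , (λ _ → CFG.Generates balanced) , (λ _ → CFG.Generates single) ,
  (λ _ → (balanced , (λ u∈ → u∈) , (λ u∈ → u∈)) , (single , (λ u∈ → u∈) , (λ u∈ → u∈))) , (λ w∈ → w∈) , (λ w∈ → w∈)

blocks∈balancedω : ∀ n → blocks a₄ b₄ c₄ n n ∈ balancedω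
blocks∈balancedω n = zero , Balanced.word n , constω c₄ , Balanced.word-generated n ,
  constω-^ω (CFG.Generates single) Single.c-generated ,
  λ i → sym (++ω-assoc (replicate n a₄) (replicate n b₄) (constω c₄) i)

balancedω⇒blocks : ∀ {x} → x ∈ balancedω → ∃ λ n → x ≗ blocks a₄ b₄ c₄ n n
balancedω⇒blocks {x} (_ , u , y , u∈ , y∈ , x≗) = as-blocks (Balanced.generated u∈)
  where
  as-blocks : (∃ λ l → u ≡ Balanced.word l) → ∃ λ n → x ≗ blocks a₄ b₄ c₄ n n
  as-blocks (l , refl) = l , λ i → trans (x≗ i)
    (trans (++ω-cong u (λ j → Single.ω-generated j y∈) i)
           (++ω-assoc (replicate l a₄) (replicate l b₄) (constω c₄) i))

blocks-injective : ∀ n m n′ m′ → blocks {4} a₄ b₄ c₄ n m ≗ blocks a₄ b₄ c₄ n′ m′ → n ≡ n′ × m ≡ m′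
blocks-injective (suc n) m       (suc n′) m′       eq with blocks-injective n m n′ m′ (eq ∘ suc)
... | n≡ , m≡ = cong suc n≡ , m≡
blocks-injective zero    (suc m) zero     (suc m′) eq with blocks-injective zero m zero m′ (eq ∘ suc)
... | n≡ , m≡ = refl , cong suc m≡
blocks-injective zero    zero    zero     zero     eq = refl , refl
blocks-injective (suc n) m       zero     zero     eq with () ← eq 0
blocks-injective (suc n) m       zero     (suc m′) eq with () ← eq 0
blocks-injective zero    zero    (suc n′) m′       eq with () ← eq 0
blocks-injective zero    (suc m) (suc n′) m′       eq with () ← eq 0
blocks-injective zero    zero    zero     (suc m′) eq with () ← eq 0
blocks-injective zero    (suc m) zero     zero     eq with () ← eq 0

balancedω-unused : ∀ {x} → x ∈ balancedω → x 0 ≢ d₄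
balancedω-unused x∈ x0≡d with balancedω⇒blocks x∈
... | zero  , x≗ with () ← trans (sym x0≡d) (x≗ 0)
... | suc n , x≗ with () ← trans (sym x0≡d) (x≗ 0)

balancedω∉ω-RL : (4 , balancedω) ∉ ω-RL
balancedω∉ω-RL regular = unbalanced (ω-RL-pumping a₄ b₄ c₄ regular blocks∈balancedω)
  where
  unbalanced : ¬ (∃ λ n → ∃ λ m → m ℕ.< n × blocks a₄ b₄ c₄ n m ∈ balancedω)
  unbalanced (n , m , m<n , w∈) with balancedω⇒blocks w∈
  ... | l , eq with blocks-injective n m l l eq
  ... | refl , refl = ℕ.<-irrefl refl m<n

-- Non-inclusions for strict thresholds

ω-RL⊈𝕃^> : ∀ λ₀ → ω-RL ⊈ 𝕃^> λ₀
ω-RL⊈𝕃^> λ₀ ω-RL⊆ = unused-letter {λ₀ = λ₀} (suc zero) zerosω-inhabited zerosω-unused (ω-RL⊆ zerosω∈ω-RL)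

ω-CFL∖ω-RL⊈𝕃^> : ∀ λ₀ → (ω-CFL ∖ ω-RL) ⊈ 𝕃^> λ₀
ω-CFL∖ω-RL⊈𝕃^> λ₀ ⊆𝕃^> = unused-letter {λ₀ = λ₀} d₄ (blocks∈balancedω 0) balancedω-unused
  (⊆𝕃^> (balancedω∈ω-CFL , balancedω∉ω-RL))

-- Multiples of an irrational angle

-- The Pythagorean triple 3, 4, 5 keeps all cosines rational, hence decidably ordered. Irrationality
-- of θ/π enters in the form `sine≢0`.
cosθ sinθ : ℚ
cosθ = + 3 ℚ./ 5
sinθ = + 4 ℚ./ 5

cosine sine : ℕ → ℚ
cosine zero    = 1ℚ
cosine (suc k) = cosθ ℚ.* cosine k ℚ.- sinθ ℚ.* sine k
sine zero    = 0ℚ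
sine (suc k) = sinθ ℚ.* cosine k ℚ.+ cosθ ℚ.* sine k

cosine²+sine² : ∀ k → cosine k ℚ.* cosine k ℚ.+ sine k ℚ.* sine k ≡ 1ℚ
cosine²+sine² zero    = refl
cosine²+sine² (suc k) = trans
  (solve 2 (λ x y → (con cosθ :* x :- con sinθ :* y) :* (con cosθ :* x :- con sinθ :* y)
                      :+ (con sinθ :* x :+ con cosθ :* y) :* (con sinθ :* x :+ con cosθ :* y)
                    := x :* x :+ y :* y) refl (cosine k) (sine k))
  (cosine²+sine² k)

-- Multiplied by 5ᵏ, both become integers, which are 3 and 4 modulo 5 for
-- k ≥ 1 because (3 + 4i)² ≡ 3 + 4i.
numerators : ∀ k → ∃₂ λ t u → ∃ λ p →
  fromℤ (+ 5 ℤ.* t ℤ.+ + 3) ≡ p ℚ.* cosine (suc k) × fromℤ (+ 5 ℤ.* u ℤ.+ + 4) ≡ p ℚ.* sine (suc k)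
numerators zero    = + 0 , + 0 , fromℤ (+ 5) , refl , refl
numerators (suc k) = step (numerators k)
  where
  combination : ∀ a i b j → fromℤ (a ℤ.* i ℤ.+ b ℤ.* j) ≡ fromℤ a ℚ.* fromℤ i ℚ.+ fromℤ b ℚ.* fromℤ j
  combination a i b j = trans (fromℤ-+ (a ℤ.* i) (b ℤ.* j)) (cong₂ ℚ._+_ (fromℤ-* a i) (fromℤ-* b j))

  step : (∃₂ λ t u → ∃ λ p → fromℤ (+ 5 ℤ.* t ℤ.+ + 3) ≡ p ℚ.* cosine (suc k) ×
                             fromℤ (+ 5 ℤ.* u ℤ.+ + 4) ≡ p ℚ.* sine (suc k)) →
         ∃₂ λ t u → ∃ λ p → fromℤ (+ 5 ℤ.* t ℤ.+ + 3) ≡ p ℚ.* cosine (suc (suc k)) ×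
                            fromℤ (+ 5 ℤ.* u ℤ.+ + 4) ≡ p ℚ.* sine (suc (suc k))
  step (t , u , p , cos≡ , sin≡) =
    -- The constants come from 3 · 3 - 4 · 4 = -7 = 5 · (-2) + 3 and 4 · 3 + 3 · 4 = 24 = 5 · 4 + 4.
    + 3 ℤ.* t ℤ.+ ℤ.- + 4 ℤ.* u ℤ.+ ℤ.- + 2 , + 4 ℤ.* t ℤ.+ + 3 ℤ.* u ℤ.+ + 4 , fromℤ (+ 5) ℚ.* p ,
    trans (trans (cong fromℤ (solveℤ 2 (λ t u →
              conℤ (+ 5) ⊗ (conℤ (+ 3) ⊗ t ⊕ conℤ (ℤ.- + 4) ⊗ u ⊕ conℤ (ℤ.- + 2)) ⊕ conℤ (+ 3)
                ⊜ conℤ (+ 3) ⊗ (conℤ (+ 5) ⊗ t ⊕ conℤ (+ 3)) ⊕ conℤ (ℤ.- + 4) ⊗ (conℤ (+ 5) ⊗ u ⊕ conℤ (+ 4))) refl t u))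
            (trans (combination (+ 3) (+ 5 ℤ.* t ℤ.+ + 3) (ℤ.- + 4) (+ 5 ℤ.* u ℤ.+ + 4))
                   (cong₂ (λ x y → fromℤ (+ 3) ℚ.* x ℚ.+ fromℤ (ℤ.- + 4) ℚ.* y) cos≡ sin≡)))
          (solve 3 (λ p x y → con (fromℤ (+ 3)) :* (p :* x) :+ con (fromℤ (ℤ.- + 4)) :* (p :* y)
                                := con (fromℤ (+ 5)) :* p :* (con cosθ :* x :- con sinθ :* y)) refl p (cosine (suc k)) (sine (suc k))) ,
    trans (trans (cong fromℤ (solveℤ 2 (λ t u →
              conℤ (+ 5) ⊗ (conℤ (+ 4) ⊗ t ⊕ conℤ (+ 3) ⊗ u ⊕ conℤ (+ 4)) ⊕ conℤ (+ 4)
                ⊜ conℤ (+ 4) ⊗ (conℤ (+ 5) ⊗ t ⊕ conℤ (+ 3)) ⊕ conℤ (+ 3) ⊗ (conℤ (+ 5) ⊗ u ⊕ conℤ (+ 4))) refl t u))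
            (trans (combination (+ 4) (+ 5 ℤ.* t ℤ.+ + 3) (+ 3) (+ 5 ℤ.* u ℤ.+ + 4))
                   (cong₂ (λ x y → fromℤ (+ 4) ℚ.* x ℚ.+ fromℤ (+ 3) ℚ.* y) cos≡ sin≡)))
          (solve 3 (λ p x y → con (fromℤ (+ 4)) :* (p :* x) :+ con (fromℤ (+ 3)) :* (p :* y)
                                := con (fromℤ (+ 5)) :* p :* (con sinθ :* x :+ con cosθ :* y)) refl p (cosine (suc k)) (sine (suc k)))

-- In absolute values the equation would make 4 a multiple of 5.
5u+4≢0 : ∀ u → + 5 ℤ.* u ℤ.+ + 4 ≢ + 0
5u+4≢0 u eq = no-multiple ℤ.∣ u ∣ (trans (sym (ℤ.abs-* (+ 5) u)) (cong ℤ.∣_∣ (ℤ.i-j≡0⇒i≡j (+ 5 ℤ.* u) (ℤ.- + 4) eq)))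
  where
  no-multiple : ∀ n → 5 ℕ.* n ≢ 4
  no-multiple n eq with n | trans (ℕ.*-comm n 5) eq
  ... | zero  | ()
  ... | suc m | ()

sine≢0 : ∀ k → sine (suc k) ≢ 0ℚ
sine≢0 k sin≡0 = vanish (numerators k)
  where
  vanish : ¬ (∃₂ λ t u → ∃ λ p → fromℤ (+ 5 ℤ.* t ℤ.+ + 3) ≡ p ℚ.* cosine (suc k) ×
                                 fromℤ (+ 5 ℤ.* u ℤ.+ + 4) ≡ p ℚ.* sine (suc k))
  vanish (_ , u , p , _ , sin≡) =
    5u+4≢0 u (fromℤ-injective (trans sin≡ (trans (cong (p ℚ.*_) sin≡0) (ℚ.*-zeroʳ p))))

p≢0⇒0<p*p : ∀ {p} → p ≢ 0ℚ → 0ℚ ℚ.< p ℚ.* p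
p≢0⇒0<p*p {p} p≢0 with p ℚ.* p ℚ.≤? 0ℚ
... | no p²≰0  = ℚ.≰⇒> p²≰0
... | yes p²≤0 = contradiction (ℚ.∣p∣≡0⇒p≡0 p (ℚ.≤-antisym ∣p∣≤0 (ℚ.0≤∣p∣ p))) p≢0
  where
  ∣p∣≤0 : ∣ p ∣ ℚ.≤ 0ℚ
  ∣p∣≤0 = ℚ.≮⇒≥ λ 0<∣p∣ → ℚ.<-irrefl refl (ℚ.<-≤-trans (ℚ.positive⁻¹ (∣ p ∣ ℚ.* ∣ p ∣)
    {{ℚ.pos*pos⇒pos (∣ p ∣) {{ℚ.positive 0<∣p∣}} (∣ p ∣) {{ℚ.positive 0<∣p∣}}}})
    (subst (ℚ._≤ 0ℚ) (sym (∣p∣*∣p∣ p)) p²≤0))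

cosine²≤1 : ∀ k → cosine k ℚ.* cosine k ℚ.≤ 1ℚ
cosine²≤1 k = subst (cosine k ℚ.* cosine k ℚ.≤_) (cosine²+sine² k) (p≤p+q (0≤p*p (sine k)))

cosine²<1 : ∀ k → cosine (suc k) ℚ.* cosine (suc k) ℚ.< 1ℚ
cosine²<1 k = subst₂ ℚ._<_ (ℚ.+-identityʳ (cosine (suc k) ℚ.* cosine (suc k))) (cosine²+sine² (suc k))
  (ℚ.+-monoʳ-< (cosine (suc k) ℚ.* cosine (suc k)) (p≢0⇒0<p*p (sine≢0 k)))

-- A maximum of finitely many numbers below one. No q serves for all k together, since the multiples
-- of θ come arbitrarily close to multiples of π.
cosine²-gap : ∀ n → ∃ λ q → q ℚ.< 1ℚ × (∀ k → k ℕ.< n → cosine (suc k) ℚ.* cosine (suc k) ℚ.≤ q)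
cosine²-gap zero    = 0ℚ , ℚ.positive⁻¹ 1ℚ , λ k ()
cosine²-gap (suc n) = extend (cosine²-gap n)
  where
  extend : (∃ λ q → q ℚ.< 1ℚ × (∀ k → k ℕ.< n → cosine (suc k) ℚ.* cosine (suc k) ℚ.≤ q)) →
           ∃ λ q → q ℚ.< 1ℚ × (∀ k → k ℕ.< suc n → cosine (suc k) ℚ.* cosine (suc k) ℚ.≤ q)
  extend (q , q<1 , cos≤q) with ℚ.≤-total q (cosine (suc n) ℚ.* cosine (suc n))
  ... | inj₁ q≤ = _ , cosine²<1 n , λ k k<1+n → case ℕ.m<1+n⇒m<n∨m≡n k<1+n of λ
    { (inj₁ k<n)  → ℚ.≤-trans (cos≤q k k<n) q≤
    ; (inj₂ refl) → ℚ.≤-refl }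
  ... | inj₂ ≤q = q , q<1 , λ k k<1+n → case ℕ.m<1+n⇒m<n∨m≡n k<1+n of λ
    { (inj₁ k<n)  → cos≤q k k<n
    ; (inj₂ refl) → ≤q }

module ℂ+ = CommutativeSemigroup ℂR.+-commutativeSemigroup
module ℂ* = CommutativeSemigroup ℂR.*-commutativeSemigroup

-- The qubit

ℂ² : LeftModule ℂ-ring 0ℓ 0ℓ
ℂ² = DirectProduct.leftModule TensorUnit.leftModule TensorUnit.leftModule

⟪_,_⟫ : ℂ × ℂ → ℂ × ℂ → ℂ
⟪ (x₁ , x₂) , (y₁ , y₂) ⟫ = conj x₁ *ℂ y₁ +ℂ conj x₂ *ℂ y₂

conj-+ : ∀ z w → conj z +ℂ conj w ≈ℂ conj (z +ℂ w)
conj-+ z w = mk≈ℂ ≈ℝ-refl (termwise λ n → sym (ℚ.neg-distrib-+ (seq (im z) n) (seq (im w) n)))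

conj-swap : ∀ z w → conj z *ℂ w ≈ℂ conj (conj w *ℂ z)
conj-swap z w = mk≈ℂ
  (termwise λ n → solve 4 (λ a b c d → a :* c :+ :- ((:- b) :* d) := c :* a :+ :- ((:- d) :* b)) refl
    (seq (re z) n) (seq (im z) n) (seq (re w) n) (seq (im w) n))
  (termwise λ n → solve 4 (λ a b c d → a :* d :+ (:- b) :* c := :- (c :* b :+ (:- d) :* a)) refl
    (seq (re z) n) (seq (im z) n) (seq (re w) n) (seq (im w) n))

re⟪x,x⟫ : ∀ (x : ℂ × ℂ) → re ⟪ x , x ⟫ ≈ℝ ∣ proj₁ x ∣² +ℝ ∣ proj₂ x ∣²
re⟪x,x⟫ (z , w) = termwise λ n →
  solve 4 (λ a b c d → (a :* a :+ :- ((:- b) :* b)) :+ (c :* c :+ :- ((:- d) :* d))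
                         := (a :* a :+ b :* b) :+ (c :* c :+ d :* d)) refl
    (seq (re z) n) (seq (im z) n) (seq (re w) n) (seq (im w) n)

-- Where |x| ≥ ε, also t ≥ ε²; so t is asked to be within ε² of zero.
square-null : ∀ {x t} → (∀ n → seq x n ℚ.* seq x n ℚ.≤ seq t n) → t ≈ℝ 0ℝ → x ≈ℝ 0ℝ
square-null {x} {t} x²≤t t≈0 = mk≈ λ ε 0<ε →
  eventually (λ n t<ε² → small ε 0<ε n t<ε²)
    (close t≈0 (ε ℚ.* ε) (ℚ.positive⁻¹ (ε ℚ.* ε) {{ℚ.pos*pos⇒pos ε {{ℚ.positive 0<ε}} ε {{ℚ.positive 0<ε}}}}))
  where
  small : ∀ ε → 0ℚ ℚ.< ε → ∀ n → ∣ seq t n ℚ.- 0ℚ ∣ ℚ.< ε ℚ.* ε → ∣ seq x n ℚ.- 0ℚ ∣ ℚ.< ε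
  small ε 0<ε n t<ε² = ℚ.≰⇒> λ ε≤∣x∣ → ℚ.<-irrefl refl (ℚ.≤-<-trans
    (ℚ.≤-trans (*-mono-≤-nonNeg (ℚ.<⇒≤ 0<ε) (ℚ.<⇒≤ 0<ε) ε≤∣x∣ ε≤∣x∣)
      (subst (ℚ._≤ seq t n ℚ.- 0ℚ) (sym (∣p∣*∣p∣ (seq x n ℚ.- 0ℚ)))
        (subst₂ ℚ._≤_ (cong₂ ℚ._*_ (sym (ℚ.+-identityʳ (seq x n))) (sym (ℚ.+-identityʳ (seq x n))))
          (sym (ℚ.+-identityʳ (seq t n))) (x²≤t n))))
    (ℚ.≤-<-trans (p≤∣p∣ (seq t n ℚ.- 0ℚ)) t<ε²))

∣∣²-nonNeg : ∀ z n → 0ℚ ℚ.≤ seq ∣ z ∣² n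
∣∣²-nonNeg z n = ℚ.+-mono-≤ (0≤p*p (seq (re z) n)) (0≤p*p (seq (im z) n))

∣∣²-null : ∀ {z t} → (∀ n → seq ∣ z ∣² n ℚ.≤ seq t n) → t ≈ℝ 0ℝ → z ≈ℂ 0ℂ
∣∣²-null {z} z²≤t t≈0 = mk≈ℂ
  (square-null (λ n → ℚ.≤-trans (p≤p+q (0≤p*p (seq (im z) n))) (z²≤t n)) t≈0)
  (square-null (λ n → ℚ.≤-trans (p≤q+p (0≤p*p (seq (re z) n))) (z²≤t n)) t≈0)

qubit : HilbertSpace
qubit = record
  { vectorSpace = ℂ²
  ; ⟨_∣_⟩      = ⟪_,_⟫
  ; ⟨∣⟩-cong   = λ (p₁ , p₂) (q₁ , q₂) → ℂR.+-cong (ℂR.*-cong (conj-cong p₁) q₁) (ℂR.*-cong (conj-cong p₂) q₂)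
  ; ⟨∣⟩-+ʳ     = λ (x₁ , x₂) (y₁ , y₂) (z₁ , z₂) →
      ℂR.trans (ℂR.+-cong (ℂR.distribˡ (conj x₁) y₁ z₁) (ℂR.distribˡ (conj x₂) y₂ z₂))
               (ℂ+.interchange (conj x₁ *ℂ y₁) (conj x₁ *ℂ z₁) (conj x₂ *ℂ y₂) (conj x₂ *ℂ z₂))
  ; ⟨∣⟩-*ʳ     = λ c (x₁ , x₂) (y₁ , y₂) →
      ℂR.trans (ℂR.+-cong (ℂ*.x∙yz≈y∙xz (conj x₁) c y₁) (ℂ*.x∙yz≈y∙xz (conj x₂) c y₂))
               (ℂR.sym (ℂR.distribˡ c (conj x₁ *ℂ y₁) (conj x₂ *ℂ y₂)))
  ; ⟨∣⟩-conj   = λ (x₁ , x₂) (y₁ , y₂) →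
      ℂR.trans (ℂR.+-cong (conj-swap x₁ y₁) (conj-swap x₂ y₂)) (conj-+ (conj y₁ *ℂ x₁) (conj y₂ *ℂ x₂))
  ; ⟨∣⟩-nonNeg = nonNeg
  ; ⟨∣⟩-def    = λ (x₁ , x₂) x≈0 →
      let norm≈0 = ≈ℝ-trans (≈ℝ-sym (re⟪x,x⟫ (x₁ , x₂))) (re-≈ x≈0)
      in ∣∣²-null (λ n → p≤p+q (∣∣²-nonNeg x₂ n)) norm≈0 , ∣∣²-null (λ n → p≤q+p (∣∣²-nonNeg x₁ n)) norm≈0
  ; dim         = 2
  ; basis       = basis
  ; orthonormal = λ
      { zero zero → mk≈ℂ (termwise λ _ → refl) (termwise λ _ → refl)
      ; zero (suc zero) → mk≈ℂ (termwise λ _ → refl) (termwise λ _ → refl)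
      ; (suc zero) zero → mk≈ℂ (termwise λ _ → refl) (termwise λ _ → refl)
      ; (suc zero) (suc zero) → mk≈ℂ (termwise λ _ → refl) (termwise λ _ → refl) }
  ; spanning    = λ (x₁ , x₂) → coefficients x₁ x₂ ,
      ℂR.sym (ℂR.trans (ℂR.+-cong (ℂR.*-identityʳ x₁) (ℂR.trans (ℂR.+-identityʳ _) (ℂR.zeroʳ x₂))) (ℂR.+-identityʳ x₁)) ,
      ℂR.sym (ℂR.trans (ℂR.+-cong (ℂR.zeroʳ x₁) (ℂR.trans (ℂR.+-identityʳ _) (ℂR.*-identityʳ x₂))) (ℂR.+-identityˡ x₂))
  }
  where
  basis : Fin 2 → ℂ × ℂ
  basis zero       = 1ℂ , 0ℂ
  basis (suc zero) = 0ℂ , 1ℂ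

  coefficients : ℂ → ℂ → Fin 2 → ℂ
  coefficients x₁ x₂ zero       = x₁
  coefficients x₁ x₂ (suc zero) = x₂

  nonNeg : ∀ x → 0ℝ ≤ℝ re ⟪ x , x ⟫
  nonNeg (z , w) = mk≤ λ ε 0<ε → 0 , λ n _ → ℚ.≤-trans
    (subst (0ℚ ℚ.≤_)
      (solve 4 (λ a b c d → (a :* a :+ b :* b) :+ (c :* c :+ d :* d)
                              := (a :* a :+ :- ((:- b) :* b)) :+ (c :* c :+ :- ((:- d) :* d))) refl
         (seq (re z) n) (seq (im z) n) (seq (re w) n) (seq (im w) n))
      (ℚ.+-mono-≤ (∣∣²-nonNeg z n) (∣∣²-nonNeg w n)))
    (p≤p+q (ℚ.<⇒≤ 0<ε))

-- Rotations

-- Componentwise, which spares the identities below the terms from a zero imaginary part.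
scale : ℚ → ℂ → ℂ
re (scale q z) = fromℚ q *ℝ re z
im (scale q z) = fromℚ q *ℝ im z

scale-cong : ∀ q {z w} → z ≈ℂ w → scale q z ≈ℂ scale q w
scale-cong q z≈w = mk≈ℂ (*ℝ-cong ≈ℝ-refl (re-≈ z≈w)) (*ℝ-cong ≈ℝ-refl (im-≈ z≈w))

scale-+ : ∀ q z w → scale q (z +ℂ w) ≈ℂ scale q z +ℂ scale q w
scale-+ q z w = mk≈ℂ (termwise λ n → ℚ.*-distribˡ-+ q (seq (re z) n) (seq (re w) n))
                     (termwise λ n → ℚ.*-distribˡ-+ q (seq (im z) n) (seq (im w) n))

scale-* : ∀ q k z → scale q (k *ℂ z) ≈ℂ k *ℂ scale q z
scale-* q k z = mk≈ℂ
  (termwise λ n → solve 5 (λ q a b c d → q :* (a :* c :+ :- (b :* d)) := a :* (q :* c) :+ :- (b :* (q :* d))) refl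
    q (seq (re k) n) (seq (im k) n) (seq (re z) n) (seq (im z) n))
  (termwise λ n → solve 5 (λ q a b c d → q :* (a :* d :+ b :* c) := a :* (q :* d) :+ b :* (q :* c)) refl
    q (seq (re k) n) (seq (im k) n) (seq (re z) n) (seq (im z) n))

scale-neg : ∀ q z → scale q (-ℂ z) ≈ℂ -ℂ scale q z
scale-neg q z = mk≈ℂ (termwise λ n → sym (ℚ.neg-distribʳ-* q (seq (re z) n)))
                     (termwise λ n → sym (ℚ.neg-distribʳ-* q (seq (im z) n)))

rotate : ℚ → ℚ → ℂ × ℂ → ℂ × ℂ
rotate c s (x , y) = scale c x +ℂ scale (ℚ.- s) y , scale s x +ℂ scale c y

module _ (c s : ℚ) (c²+s²≡1 : c ℚ.* c ℚ.+ s ℚ.* s ≡ 1ℚ) where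

  private
    cancel : ∀ {lhs} x → lhs ≡ (c ℚ.* c ℚ.+ s ℚ.* s) ℚ.* x → lhs ≡ x
    cancel x eq = trans eq (trans (cong (ℚ._* x) c²+s²≡1) (ℚ.*-identityˡ x))

  combination-+ : ∀ p q x x′ y y′ → scale p (x +ℂ x′) +ℂ scale q (y +ℂ y′) ≈ℂ
                                    (scale p x +ℂ scale q y) +ℂ (scale p x′ +ℂ scale q y′)
  combination-+ p q x x′ y y′ = ℂR.trans (ℂR.+-cong (scale-+ p x x′) (scale-+ q y y′))
    (ℂ+.interchange (scale p x) (scale p x′) (scale q y) (scale q y′))

  combination-* : ∀ p q k x y → scale p (k *ℂ x) +ℂ scale q (k *ℂ y) ≈ℂ k *ℂ (scale p x +ℂ scale q y)
  combination-* p q k x y = ℂR.trans (ℂR.+-cong (scale-* p k x) (scale-* q k y))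
    (ℂR.sym (ℂR.distribˡ k (scale p x) (scale q y)))

  combination-neg : ∀ p q x y → scale p (-ℂ x) +ℂ scale q (-ℂ y) ≈ℂ -ℂ (scale p x +ℂ scale q y)
  combination-neg p q x y = ℂR.trans (ℂR.+-cong (scale-neg p x) (scale-neg q y)) (mk≈ℂ
    (termwise λ n → sym (ℚ.neg-distrib-+ (p ℚ.* seq (re x) n) (q ℚ.* seq (re y) n)))
    (termwise λ n → sym (ℚ.neg-distrib-+ (p ℚ.* seq (im x) n) (q ℚ.* seq (im y) n))))

  combination-0 : ∀ p q → scale p 0ℂ +ℂ scale q 0ℂ ≈ℂ 0ℂ
  combination-0 p q = mk≈ℂ (termwise λ _ → cong₂ ℚ._+_ (ℚ.*-zeroʳ p) (ℚ.*-zeroʳ q))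
                           (termwise λ _ → cong₂ ℚ._+_ (ℚ.*-zeroʳ p) (ℚ.*-zeroʳ q))

  rotate-unitary : IsUnitary qubit (rotate c s)
  rotate-unitary = record
    { isLinear = record
      { +ᴹ-isGroupHomomorphism = record
        { isMonoidHomomorphism = record
          { isMagmaHomomorphism = record
            { isRelHomomorphism = record
              { cong = λ (p , q) → ℂR.+-cong (scale-cong c p) (scale-cong (ℚ.- s) q) ,
                                   ℂR.+-cong (scale-cong s p) (scale-cong c q) }
            ; homo = λ (x , y) (x′ , y′) → combination-+ c (ℚ.- s) x x′ y y′ , combination-+ s c x x′ y y′
            }
          ; ε-homo = combination-0 c (ℚ.- s) , combination-0 s c
          }
        ; ⁻¹-homo = λ (x , y) → combination-neg c (ℚ.- s) x y , combination-neg s c x y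
        }
      ; *ₗ-homo = λ k (x , y) → combination-* c (ℚ.- s) k x y , combination-* s c k x y
      }
    ; _†        = rotate c (ℚ.- s)
    ; isAdjoint = λ (x , y) (z , w) → mk≈ℂ
        (termwise λ n → solve 10 (λ c s a b d e f g h i →
            ((c :* a :+ :- (:- s) :* d) :* f :+ :- ((:- (c :* b :+ :- (:- s) :* e)) :* g))
              :+ (((:- s) :* a :+ c :* d) :* h :+ :- ((:- ((:- s) :* b :+ c :* e)) :* i))
            := (a :* (c :* f :+ (:- s) :* h) :+ :- ((:- b) :* (c :* g :+ (:- s) :* i)))
              :+ (d :* (s :* f :+ c :* h) :+ :- ((:- e) :* (s :* g :+ c :* i)))) refl
          c s (seq (re x) n) (seq (im x) n) (seq (re y) n) (seq (im y) n)
              (seq (re z) n) (seq (im z) n) (seq (re w) n) (seq (im w) n))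
        (termwise λ n → solve 10 (λ c s a b d e f g h i →
            ((c :* a :+ :- (:- s) :* d) :* g :+ (:- (c :* b :+ :- (:- s) :* e)) :* f)
              :+ (((:- s) :* a :+ c :* d) :* i :+ (:- ((:- s) :* b :+ c :* e)) :* h)
            := (a :* (c :* g :+ (:- s) :* i) :+ (:- b) :* (c :* f :+ (:- s) :* h))
              :+ (d :* (s :* g :+ c :* i) :+ (:- e) :* (s :* f :+ c :* h))) refl
          c s (seq (re x) n) (seq (im x) n) (seq (re y) n) (seq (im y) n)
              (seq (re z) n) (seq (im z) n) (seq (re w) n) (seq (im w) n))
    ; inverseˡ = λ (x , y) →
        mk≈ℂ (termwise λ n → inverse₁ (seq (re x) n) (seq (re y) n)) (termwise λ n → inverse₁ (seq (im x) n) (seq (im y) n)) ,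
        mk≈ℂ (termwise λ n → inverse₂ (seq (re x) n) (seq (re y) n)) (termwise λ n → inverse₂ (seq (im x) n) (seq (im y) n))
    ; inverseʳ = λ (x , y) →
        mk≈ℂ (termwise λ n → inverse₃ (seq (re x) n) (seq (re y) n)) (termwise λ n → inverse₃ (seq (im x) n) (seq (im y) n)) ,
        mk≈ℂ (termwise λ n → inverse₄ (seq (re x) n) (seq (re y) n)) (termwise λ n → inverse₄ (seq (im x) n) (seq (im y) n))
    }
    where
    inverse₁ : ∀ x y → c ℚ.* (c ℚ.* x ℚ.+ (ℚ.- s) ℚ.* y) ℚ.+ (ℚ.- (ℚ.- s)) ℚ.* (s ℚ.* x ℚ.+ c ℚ.* y) ≡ x
    inverse₁ x y = cancel x (solve 4 (λ c s x y →
      c :* (c :* x :+ (:- s) :* y) :+ (:- (:- s)) :* (s :* x :+ c :* y) := (c :* c :+ s :* s) :* x) refl c s x y)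

    inverse₂ : ∀ x y → (ℚ.- s) ℚ.* (c ℚ.* x ℚ.+ (ℚ.- s) ℚ.* y) ℚ.+ c ℚ.* (s ℚ.* x ℚ.+ c ℚ.* y) ≡ y
    inverse₂ x y = cancel y (solve 4 (λ c s x y →
      (:- s) :* (c :* x :+ (:- s) :* y) :+ c :* (s :* x :+ c :* y) := (c :* c :+ s :* s) :* y) refl c s x y)

    inverse₃ : ∀ x y → c ℚ.* (c ℚ.* x ℚ.+ (ℚ.- (ℚ.- s)) ℚ.* y) ℚ.+ (ℚ.- s) ℚ.* ((ℚ.- s) ℚ.* x ℚ.+ c ℚ.* y) ≡ x
    inverse₃ x y = cancel x (solve 4 (λ c s x y →
      c :* (c :* x :+ (:- (:- s)) :* y) :+ (:- s) :* ((:- s) :* x :+ c :* y) := (c :* c :+ s :* s) :* x) refl c s x y)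

    inverse₄ : ∀ x y → s ℚ.* (c ℚ.* x ℚ.+ (ℚ.- (ℚ.- s)) ℚ.* y) ℚ.+ c ℚ.* ((ℚ.- s) ℚ.* x ℚ.+ c ℚ.* y) ≡ y
    inverse₄ x y = cancel y (solve 4 (λ c s x y →
      s :* (c :* x :+ (:- (:- s)) :* y) :+ c :* ((:- s) :* x :+ c :* y) := (c :* c :+ s :* s) :* y) refl c s x y)

-- The rotation automaton

pattern a₃ = zero
pattern b₃ = suc zero
pattern c₃ = suc (suc zero)

turnCos turnSin : Fin 3 → ℚ
turnCos a₃ = cosθ
turnCos b₃ = cosθ
turnCos c₃ = 1ℚ
turnSin a₃ = sinθ
turnSin b₃ = ℚ.- sinθ
turnSin c₃ = 0ℚ

turn-unit : ∀ σ → turnCos σ ℚ.* turnCos σ ℚ.+ turnSin σ ℚ.* turnSin σ ≡ 1ℚ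
turn-unit a₃ = refl
turn-unit b₃ = refl
turn-unit c₃ = refl

rotationAutomaton : QuantumAutomaton 3
rotationAutomaton = record
  { H         = qubit
  ; s₀        = 1ℂ , 0ℂ
  ; s₀-unit   = mk≈ℂ (termwise λ _ → refl) (termwise λ _ → refl)
  ; U         = λ σ → rotate (turnCos σ) (turnSin σ)
  ; U-unitary = λ σ → rotate-unitary (turnCos σ) (turnSin σ) (turn-unit σ)
  ; F         = record
    { Member   = λ (x , y) → y ≈ℂ 0ℂ
    ; resp     = λ (_ , y≈y′) y≈0 → ℂR.trans (ℂR.sym y≈y′) y≈0
    ; 0-closed = ℂR.refl
    ; +-closed = λ y≈0 y′≈0 → ℂR.trans (ℂR.+-cong y≈0 y′≈0) (ℂR.+-identityʳ 0ℂ)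
    ; *-closed = λ c y≈0 → ℂR.trans (ℂR.*-congˡ {c} y≈0) (ℂR.zeroʳ c)
    }
  }

open QuantumAutomaton rotationAutomaton using (s₀; s₀-unit; U; Member; IsUnit; _≈ᴹ_; ≈ᴹ-trans)
open Evolution rotationAutomaton using (evolve; run-before)

-- Multiples of the angle along a word

at-angle : ℂ → ℕ → ℂ × ℂ
at-angle z k = scale (cosine k) z , scale (sine k) z

-- Heights are natural numbers, so `down` leaves only positive heights; aⁿbᵐc^ω with m ≤ n never
-- asks for more.
data Step : Fin 3 → ℕ → ℕ → Set where
  up   : ∀ {k} → Step a₃ k (suc k)
  down : ∀ {k} → Step b₃ (suc k) k
  stay : ∀ {k} → Step c₃ k k

step-cosine : ∀ {σ k l} → Step σ k l → turnCos σ ℚ.* cosine k ℚ.+ (ℚ.- turnSin σ) ℚ.* sine k ≡ cosine l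
step-cosine {k = k} up = solve 2 (λ x y →
  con cosθ :* x :+ (:- con sinθ) :* y := con cosθ :* x :- con sinθ :* y) refl (cosine k) (sine k)
step-cosine {l = l} down = solve 2 (λ x y →
  con cosθ :* (con cosθ :* x :- con sinθ :* y) :+ (:- (:- con sinθ)) :* (con sinθ :* x :+ con cosθ :* y) := x) refl (cosine l) (sine l)
step-cosine {k = k} stay = solve 2 (λ x y → con 1ℚ :* x :+ (:- con 0ℚ) :* y := x) refl (cosine k) (sine k)

step-sine : ∀ {σ k l} → Step σ k l → turnSin σ ℚ.* cosine k ℚ.+ turnCos σ ℚ.* sine k ≡ sine l
step-sine up = refl
step-sine {l = l} down = solve 2 (λ x y →
  (:- con sinθ) :* (con cosθ :* x :- con sinθ :* y) :+ con cosθ :* (con sinθ :* x :+ con cosθ :* y) := y) refl (cosine l) (sine l)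
step-sine {k = k} stay = solve 2 (λ x y → con 0ℚ :* x :+ con 1ℚ :* y := y) refl (cosine k) (sine k)

scale-combination : ∀ c s p q r z → c ℚ.* p ℚ.+ s ℚ.* q ≡ r → scale c (scale p z) +ℂ scale s (scale q z) ≈ℂ scale r z
scale-combination c s p q r z eq = mk≈ℂ (termwise λ n → pointwise (seq (re z) n)) (termwise λ n → pointwise (seq (im z) n))
  where
  pointwise : ∀ x → c ℚ.* (p ℚ.* x) ℚ.+ s ℚ.* (q ℚ.* x) ≡ r ℚ.* x
  pointwise x = trans (solve 5 (λ c s p q x → c :* (p :* x) :+ s :* (q :* x) := (c :* p :+ s :* q) :* x) refl c s p q x)
                      (cong (ℚ._* x) eq)

U-at-angle : ∀ {σ k l} z → Step σ k l → U σ (at-angle z k) ≈ᴹ at-angle z l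
U-at-angle {σ} {k} {l} z step =
  scale-combination (turnCos σ) (ℚ.- turnSin σ) (cosine k) (sine k) (cosine l) z (step-cosine step) ,
  scale-combination (turnSin σ) (turnCos σ) (cosine k) (sine k) (sine l) z (step-sine step)

U-cong : ∀ σ {v w} → v ≈ᴹ w → U σ v ≈ᴹ U σ w
U-cong σ (p , q) = ℂR.+-cong (scale-cong (turnCos σ) p) (scale-cong (ℚ.- turnSin σ) q) ,
                   ℂR.+-cong (scale-cong (turnSin σ) p) (scale-cong (turnCos σ) q)

-- F is a complex line, so unit vectors in it agree only up to a phase, and each reset may change
-- the phase.
record OnTrack (v : ℂ × ℂ) (k : ℕ) : Set where
  constructor onTrack
  field
    phase      : ℂ
    phase-unit : ∣ phase ∣² ≈ℝ 1ℝ
    position   : v ≈ᴹ at-angle phase k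

step-on-track : ∀ {σ k l v} → Step σ k l → OnTrack v k → OnTrack (U σ v) l
step-on-track {σ} {k} {v = v} step (onTrack z z-unit v≈) =
  onTrack z z-unit (≈ᴹ-trans {U σ v} (U-cong σ {v} {at-angle z k} v≈) (U-at-angle z step))

at-angle-0 : ∀ z {y} → y ≈ℂ 0ℂ → (z , y) ≈ᴹ at-angle z 0
at-angle-0 z y≈0 =
  mk≈ℂ (termwise λ n → sym (ℚ.*-identityˡ (seq (re z) n))) (termwise λ n → sym (ℚ.*-identityˡ (seq (im z) n))) ,
  ℂR.trans y≈0 (mk≈ℂ (termwise λ n → sym (ℚ.*-zeroˡ (seq (re z) n))) (termwise λ n → sym (ℚ.*-zeroˡ (seq (im z) n))))

accepting-phase : ∀ {ψ} → Member ψ → IsUnit ψ → ∣ proj₁ ψ ∣² ≈ℝ 1ℝ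
accepting-phase {z , y} y≈0 ψ-unit =
  ≈ℝ-trans (≈ℝ-sym (≈ℝ-trans (+ℝ-cong ≈ℝ-refl (∣∣²-cong y≈0)) (termwise λ n → ℚ.+-identityʳ (seq ∣ z ∣² n))))
           (≈ℝ-trans (≈ℝ-sym (re⟪x,x⟫ (z , y))) (re-≈ ψ-unit))

accepting-on-track : ∀ {ψ} → Member ψ → IsUnit ψ → OnTrack ψ 0
accepting-on-track {z , y} y≈0 ψ-unit = onTrack z (accepting-phase y≈0 ψ-unit) (at-angle-0 z y≈0)

s₀-on-track : OnTrack s₀ 0
s₀-on-track = accepting-on-track ℂR.refl s₀-unit

-- The second component of ψ vanishes, so only the cosine part of v contributes, and both phases
-- have modulus one.
fidelity : ∀ {ψ v k} → Member ψ → IsUnit ψ → OnTrack v k → ∣ ⟪ ψ , v ⟫ ∣² ≈ℝ fromℚ (cosine k ℚ.* cosine k)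
fidelity {w , y} {v} {k} y≈0 ψ-unit (onTrack z z-unit v≈) =
  ≈ℝ-trans (∣∣²-cong project) (≈ℝ-trans multiplicative
    (≈ℝ-trans (*ℝ-cong (≈ℝ-refl {fromℚ (cosine k ℚ.* cosine k)}) (*ℝ-cong (accepting-phase y≈0 ψ-unit) z-unit))
              (termwise λ _ → ℚ.*-identityʳ (cosine k ℚ.* cosine k))))
  where
  project : ⟪ (w , y) , v ⟫ ≈ℂ conj w *ℂ scale (cosine k) z
  project = ℂR.trans (ℂR.+-cong (ℂR.*-congˡ {conj w} (proj₁ v≈))
      (ℂR.trans (ℂR.*-congʳ {proj₂ v} (ℂR.trans (conj-cong y≈0) (mk≈ℂ ≈ℝ-refl (termwise λ _ → refl)))) (ℂR.zeroˡ (proj₂ v))))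
    (ℂR.+-identityʳ (conj w *ℂ scale (cosine k) z))

  multiplicative : ∣ conj w *ℂ scale (cosine k) z ∣² ≈ℝ fromℚ (cosine k ℚ.* cosine k) *ℝ (∣ w ∣² *ℝ ∣ z ∣²)
  multiplicative = termwise λ n → solve 5 (λ p a b c d →
      (a :* (p :* c) :+ :- ((:- b) :* (p :* d))) :* (a :* (p :* c) :+ :- ((:- b) :* (p :* d)))
        :+ (a :* (p :* d) :+ (:- b) :* (p :* c)) :* (a :* (p :* d) :+ (:- b) :* (p :* c))
      := (p :* p) :* ((a :* a :+ b :* b) :* (c :* c :+ d :* d))) refl
    (cosine k) (seq (re w) n) (seq (im w) n) (seq (re z) n) (seq (im z) n)

-- `bound` makes `cosine²-gap` applicable; from `settled` on, `end` is the height that every late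
-- checkpoint meets.
record Track (w : ωWord 3) (start end bound settled : ℕ) : Set where
  field
    height  : ℕ → ℕ
    initial : height 0 ≡ start
    steps   : ∀ j → Step (w j) (height j) (height (suc j))
    bounded : ∀ j → height j ℕ.≤ bound
    final   : ∀ j → settled ℕ.≤ j → height j ≡ end

track-cons : ∀ {w k l e B N} → Step (w 0) k l → k ℕ.≤ B → Track (w ∘ suc) l e B N → Track w k e B (suc N)
track-cons {w} {k} {l} {e} {B} {N} step k≤B t = record
  { height  = height′
  ; initial = refl
  ; steps   = λ { zero → subst (Step (w 0) k) (sym initial) step ; (suc j) → steps j }
  ; bounded = λ { zero → k≤B ; (suc j) → bounded j }
  ; final   = λ { (suc j) (s≤s N≤j) → final j N≤j }
  }
  where
  open Track t
  height′ : ℕ → ℕ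
  height′ zero    = k
  height′ (suc j) = height j

track-b : ∀ m l {B} → m ℕ.+ l ℕ.≤ B → Track (replicate m b₃ ++ω constω c₃) (m ℕ.+ l) l B m
track-b zero    l l≤B = record
  { height = λ _ → l ; initial = refl ; steps = λ _ → stay ; bounded = λ _ → l≤B ; final = λ _ _ → refl }
track-b (suc m) l ≤B = track-cons down ≤B (track-b m l (ℕ.<⇒≤ ≤B))

track-a : ∀ n k {y e B N} → k ℕ.+ n ℕ.≤ B → Track y (k ℕ.+ n) e B N → Track (replicate n a₃ ++ω y) k e B (n ℕ.+ N)
track-a zero    k {y} {e} {B} {N} ≤B t = subst (λ i → Track y i e B N) (ℕ.+-identityʳ k) t
track-a (suc n) k {y} {e} {B} {N} ≤B t = track-cons up (ℕ.≤-trans (ℕ.m≤m+n k (suc n)) ≤B)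
  (track-a n (suc k) (subst (ℕ._≤ B) (ℕ.+-suc k n) ≤B) (subst (λ i → Track y i e B N) (ℕ.+-suc k n) t))

track-blocks : ∀ m l → Track (blocks a₃ b₃ c₃ (m ℕ.+ l) m) 0 l (m ℕ.+ l) (m ℕ.+ l ℕ.+ m)
track-blocks m l = track-a (m ℕ.+ l) 0 ℕ.≤-refl (track-b m l ℕ.≤-refl)

module Tracked {w e B N} (t : Track w 0 e B N) where
  open Track t

  evolve-on-track : ∀ j → OnTrack (evolve w j s₀) (height j)
  evolve-on-track zero    = subst (OnTrack s₀) (sym initial) s₀-on-track
  evolve-on-track (suc j) = step-on-track (steps j) (evolve-on-track j)

  -- A reset puts the run at angle 0, which stays on the undisturbed track exactly if the height
  -- there is 0. The premise may assume that the run is on track at the checkpoint in question, as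
  -- the induction has just shown; so it can be derived from the fidelity at that checkpoint.
  run-on-track : ∀ {ψ} → OnTrack ψ 0 → ∀ c →
    (∀ i → OnTrack (run rotationAutomaton w ψ c (at c i)) (height (at c i)) → height (at c i) ≡ 0) →
    ∀ j → OnTrack (run rotationAutomaton w ψ c j) (height j)
  run-on-track ψ-track c returns zero    = subst (OnTrack s₀) (sym initial) s₀-on-track
  run-on-track {ψ} ψ-track c returns (suc j) =
    step-on-track (steps j) (restart (isCheckpoint? c j) (run-on-track ψ-track c returns j))
    where
    restart : (checkpoint? : Dec (∃ λ i → at c i ≡ j)) → OnTrack (run rotationAutomaton w ψ c j) (height j) →
              OnTrack (if does checkpoint? then ψ else run rotationAutomaton w ψ c j) (height j)
    restart (no _)           track = track
    restart (yes (i , refl)) track = subst (OnTrack ψ) (sym (returns i track)) ψ-track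

-- Value one on and off the diagonal

fromℚ-mono : ∀ {p q} → p ℚ.< q → fromℚ p <ℝ fromℚ q
fromℚ-mono {p} {q} p<q = mk< (q ℚ.- p) (p<q⇒0<q-p p<q)
  (0 , λ _ _ → ℚ.≤-reflexive (solve 2 (λ p q → p :+ (q :- p) := q) refl p q))

fromℚ-cancel : ∀ {p q} → fromℚ p <ℝ fromℚ q → p ℚ.< q
fromℚ-cancel {p} (mk< g 0<g (N , p+g≤q)) =
  ℚ.<-≤-trans (subst (ℚ._< p ℚ.+ g) (ℚ.+-identityʳ p) (ℚ.+-monoʳ-< p 0<g)) (p+g≤q N ℕ.≤-refl)

diagonal-accepted : ∀ n → L^=1 rotationAutomaton (blocks a₃ b₃ c₃ n n)
diagonal-accepted n = subst (λ l → L^=1 rotationAutomaton (blocks a₃ b₃ c₃ l n)) (ℕ.+-identityʳ n) (below-1 , above)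
  where
  t : Track (blocks a₃ b₃ c₃ (n ℕ.+ 0) n) 0 0 (n ℕ.+ 0) (n ℕ.+ 0 ℕ.+ n)
  t = track-blocks n 0

  open Track t
  open Tracked t

  w : ωWord 3
  w = blocks a₃ b₃ c₃ (n ℕ.+ 0) n

  -- The first checkpoint alone bounds the infimum: no reset precedes it, and its fidelity is a
  -- squared cosine.
  below-1 : ∀ {q} → below (fᴰ rotationAutomaton w) q → below (fromℝ 1ℝ) q
  below-1 {q} ((ψ , ψ∈F , ψ-unit) , c , r , q<r , r<) =
    fromℚ-mono (ℚ.<-≤-trans (ℚ.<-trans q<r (fromℚ-cancel r<cos²)) (cosine²≤1 (height (at c 0))))
    where
    r<cos² : fromℚ r <ℝ fromℚ (cosine (height (at c 0)) ℚ.* cosine (height (at c 0)))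
    r<cos² = <ℝ-resp-≈ (r< 0) (fidelity {ψ} ψ∈F ψ-unit
      (subst (λ v → OnTrack v (height (at c 0))) (sym (run-before w ψ c (at c 0) ℕ.≤-refl)) (evolve-on-track (at c 0))))

  -- All checkpoints lie in the c-tail, where the rotations have cancelled.
  after : Checkpoints
  after = record { at = λ i → (n ℕ.+ 0 ℕ.+ n) ℕ.+ i ; increasing = λ i → ℕ.+-monoʳ-< (n ℕ.+ 0 ℕ.+ n) (ℕ.n<1+n i) }

  settled : ∀ i → height (at after i) ≡ 0
  settled i = final (at after i) (ℕ.m≤m+n (n ℕ.+ 0 ℕ.+ n) i)

  above : ∀ {q} → below (fromℝ 1ℝ) q → below (fᴰ rotationAutomaton w) q
  above {q} q<1 = s₀-accepted (ℚ.<-dense (fromℚ-cancel {q} {1ℚ} q<1))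
    where
    s₀-accepted : (∃ λ r → q ℚ.< r × r ℚ.< 1ℚ) → below (fᴰ rotationAutomaton w) q
    s₀-accepted (r , q<r , r<1) = (s₀ , ℂR.refl , s₀-unit) , after , r , q<r , λ i →
      <ℝ-resp-≈ (fromℚ-mono r<1) (≈ℝ-sym (fidelity {s₀} ℂR.refl s₀-unit
        (subst (OnTrack _) (settled i) (run-on-track s₀-on-track after (λ i _ → settled i) (at after i)))))

-- Take q below one but above cos² at all heights from 1 to n. Value one would give a strategy whose
-- fidelities exceed q, hence with all checkpoints at height 0, whereas the height settles at
-- `suc l`.
off-diagonal-rejected : ∀ m l → ¬ L^=1 rotationAutomaton (blocks a₃ b₃ c₃ (m ℕ.+ suc l) m)
off-diagonal-rejected m l (_ , above) = gap-contradiction (cosine²-gap n)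
  where
  n N : ℕ
  n = m ℕ.+ suc l
  N = n ℕ.+ m

  t : Track (blocks a₃ b₃ c₃ n m) 0 (suc l) n N
  t = track-blocks m (suc l)

  open Track t
  open Tracked t

  w : ωWord 3
  w = blocks a₃ b₃ c₃ n m

  gap-contradiction : ¬ (∃ λ q → q ℚ.< 1ℚ × (∀ k → k ℕ.< n → cosine (suc k) ℚ.* cosine (suc k) ℚ.≤ q))
  gap-contradiction (q , q<1 , cos²≤q) = accepted (above {q} (fromℚ-mono q<1))
    where
    accepted : ¬ below (fᴰ rotationAutomaton w) q
    -- The checkpoint with index N lies at position N or later, thus in the settled part, where
    -- height 0 is impossible.
    accepted ((ψ , ψ∈F , ψ-unit) , c , r , q<r , r<) = contradiction
        (trans (sym (final (at c N) (index≤at c N))) (returns N (run-on-track ψ-track c returns (at c N)))) λ ()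
      where
      ψ-track : OnTrack ψ 0
      ψ-track = accepting-on-track ψ∈F ψ-unit

      height-0 : ∀ k → k ℕ.≤ n → r ℚ.< cosine k ℚ.* cosine k → k ≡ 0
      height-0 zero    _   _      = refl
      height-0 (suc k) k<n r<cos² =
        contradiction (ℚ.<-trans q<r (ℚ.<-≤-trans r<cos² (cos²≤q k k<n))) (ℚ.<-irrefl refl)

      returns : ∀ i → OnTrack (run rotationAutomaton w ψ c (at c i)) (height (at c i)) → height (at c i) ≡ 0
      returns i track = height-0 (height (at c i)) (bounded (at c i))
        (fromℚ-cancel (<ℝ-resp-≈ (r< i) (fidelity {ψ} ψ∈F ψ-unit track)))

𝕃^=1⊈ω-RL : 𝕃^=1 ⊈ ω-RL
𝕃^=1⊈ω-RL 𝕃^=1⊆ = unbalanced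
  (ω-RL-pumping a₃ b₃ c₃ (𝕃^=1⊆ (rotationAutomaton , (λ w∈ → w∈) , (λ w∈ → w∈))) diagonal-accepted)
  where
  unbalanced : ¬ (∃ λ n → ∃ λ m → m ℕ.< n × L^=1 rotationAutomaton (blocks a₃ b₃ c₃ n m))
  -- The surplus n - m is positive and is written as the successor of `n ∸ suc m`.
  unbalanced (n , m , m<n , w∈) = off-diagonal-rejected m (n ℕ.∸ suc m)
    (subst (λ l → L^=1 rotationAutomaton (blocks a₃ b₃ c₃ l m))
      (sym (trans (ℕ.+-suc m (n ℕ.∸ suc m)) (ℕ.m+[n∸m]≡n m<n))) w∈)

theorem9 : (∀ (λ₀ : ℝ) → 0ℝ ≤ℝ λ₀ → λ₀ <ℝ 1ℝ → ω-RL ⊈ 𝕃^> λ₀) ×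
    (∀ (λ₀ : ℝ) → 0ℝ ≤ℝ λ₀ → λ₀ <ℝ 1ℝ → (ω-CFL ∖ ω-RL) ⊈ 𝕃^> λ₀) ×
    (𝕃^=1 ⊈ ω-RL)
theorem9 = (λ λ₀ _ _ → ω-RL⊈𝕃^> λ₀) , (λ λ₀ _ _ → ω-CFL∖ω-RL⊈𝕃^> λ₀) , 𝕃^=1⊈ω-RL
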